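{- Let $n\ge 3$ be an integer and let $G$ be a graph cospectral with the double star $P_2(1,n)$. Then the set of non-isolated vertices of $G$ can be partitioned into four nonempty sets $A,B,C,D$ such that the induced subgraphs $G[A\cup B]$, $G[B\cup C]$ and $G[C\cup D]$ are all complete bipartite graphs.
   Context: All graphs are finite, simple and undirected. The spectrum of a graph is the multiset of eigenvalues of its adjacency matrix; two graphs are cospectral if they have the same spectrum. For integers $a,b\ge 0$, the double star $P_2(a,b)$ is the tree obtained from the stars $K_{1,a}$ and $K_{1,b}$ by adding an edge between their center vertices. For $S\subseteq V(G)$, $G[S]$ denotes the subgraph induced by $S$. -}

module Defs where

open import Data.Nat using (ℕ; zero; suc; _+_; _<ᵇ_; _≡ᵇ_)
open import Data.Integer as ℤ using (ℤ; +_; -_)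
open import Data.Fin using (Fin; zero; suc; toℕ; punchIn)
open import Data.Bool using (Bool; true; false; _∧_; _∨_; if_then_else_; not)
open import Data.Bool.Properties using (∨-comm)
open import Data.List using (List; []; _∷_; map)
open import Data.Product using (Σ; ∃; _×_; _,_)
open import Data.Sum using (_⊎_)
open import Relation.Nullary using (¬_)
open import Relation.Binary.PropositionalEquality using (_≡_; refl)
open import Function.Bundles using (_⇔_)

record Graph (N : ℕ) : Set where
  field
    adj    : Fin N → Fin N → Bool
    sym    : ∀ u v → adj u v ≡ adj v u
    irrefl : ∀ v → adj v v ≡ false
open Graph public

-- Integer polynomials as ascending coefficient lists

Poly : Set
Poly = List ℤ

padd : Poly → Poly → Poly
padd [] q = q
padd (a ∷ p) [] = a ∷ p
padd (a ∷ p) (b ∷ q) = (a ℤ.+ b) ∷ padd p q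

pneg : Poly → Poly
pneg = map (-_)

pmul : Poly → Poly → Poly
pmul [] q = []
pmul (a ∷ p) q = padd (map (a ℤ.*_) q) ((+ 0) ∷ pmul p q)

coeff : Poly → ℕ → ℤ
coeff [] _ = + 0
coeff (a ∷ p) zero = a
coeff (a ∷ p) (suc i) = coeff p i

altSum : ∀ m → (Fin m → Poly) → Poly
altSum zero f = []
altSum (suc m) f = padd (f zero) (pneg (altSum m (λ j → f (suc j))))

det : ∀ n → (Fin n → Fin n → Poly) → Poly
det zero M = (+ 1) ∷ []
det (suc n) M =
  altSum (suc n) (λ j → pmul (M zero j) (det n (λ i k → M (suc i) (punchIn j k))))

b2z : Bool → ℤ
b2z true = + 1
b2z false = + 0

eqFin : ∀ {N} → Fin N → Fin N → Bool
eqFin u v = toℕ u ≡ᵇ toℕ v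

charPoly : ∀ {N} → Graph N → Poly
charPoly {N} G = det N (λ i j →
  if eqFin i j then (- b2z (adj G i j)) ∷ (+ 1) ∷ [] else (- b2z (adj G i j)) ∷ [])

-- cospectral: same characteristic polynomial (= same multiset of eigenvalues)
Cospectral : ∀ {N M} → Graph N → Graph M → Set
Cospectral G H = ∀ i → coeff (charPoly G) i ≡ coeff (charPoly H) i

-- Double star P₂(a,b): vertex 0 = centre of K_{1,a}, vertex 1 = centre of
-- K_{1,b}; vertices 2..a+1 are the leaves of 0, vertices a+2..a+b+1 those of 1.

dsDir : ℕ → ℕ → ℕ → ℕ → Bool
dsDir a b u v =
  ((u ≡ᵇ 0) ∧ ((0 <ᵇ v) ∧ (v <ᵇ suc (suc a))))
  ∨ ((u ≡ᵇ 1) ∧ ((suc a <ᵇ v) ∧ (v <ᵇ suc (suc (a + b)))))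

dsAdj : ∀ a b → Fin (2 + a + b) → Fin (2 + a + b) → Bool
dsAdj a b u v = dsDir a b (toℕ u) (toℕ v) ∨ dsDir a b (toℕ v) (toℕ u)

dsIrrefl : ∀ a b (v : Fin (2 + a + b)) → dsAdj a b v v ≡ false
dsIrrefl a b zero = refl
dsIrrefl a b (suc zero) = refl
dsIrrefl a b (suc (suc v)) = refl

doubleStar : (a b : ℕ) → Graph (2 + a + b)
doubleStar a b = record
  { adj = dsAdj a b
  ; sym = λ u v → ∨-comm (dsDir a b (toℕ u) (toℕ v)) (dsDir a b (toℕ v) (toℕ u))
  ; irrefl = dsIrrefl a b
  }

VSet : ℕ → Set
VSet N = Fin N → Bool

_∈_ : ∀ {N} → Fin N → VSet N → Set
v ∈ S = S v ≡ true

_∪_ : ∀ {N} → VSet N → VSet N → VSet N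
(S ∪ T) v = S v ∨ T v

Nonempty : ∀ {N} → VSet N → Set
Nonempty S = ∃ λ v → v ∈ S

Disjoint : ∀ {N} → VSet N → VSet N → Set
Disjoint S T = ∀ v → ¬ (v ∈ S × v ∈ T)

NonIsolated : ∀ {N} → Graph N → Fin N → Set
NonIsolated G v = ∃ λ w → adj G v w ≡ true

IsPartition4 : ∀ {N} → Graph N → (A B C D : VSet N) → Set
IsPartition4 G A B C D =
  Nonempty A × Nonempty B × Nonempty C × Nonempty D ×
  Disjoint A B × Disjoint A C × Disjoint A D ×
  Disjoint B C × Disjoint B D × Disjoint C D ×
  (∀ v → NonIsolated G v ⇔ (v ∈ (A ∪ (B ∪ (C ∪ D)))))

InducedCompleteBipartite : ∀ {N} → Graph N → VSet N → Set
InducedCompleteBipartite G S =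
  Σ (VSet _) λ X → Σ (VSet _) λ Y →
    (∀ v → v ∈ S ⇔ (v ∈ X ⊎ v ∈ Y)) ×
    Disjoint X Y × Nonempty X × Nonempty Y ×
    (∀ u v → u ∈ X → v ∈ Y → adj G u v ≡ true) ×
    (∀ u v → u ∈ X → v ∈ X → adj G u v ≡ false) ×
    (∀ u v → u ∈ Y → v ∈ Y → adj G u v ≡ false)

{-# OPTIONS --safe #-}
-- The coefficient of xᴺ⁻ᵏ in the characteristic polynomial is the sum of the k × k principal minors
-- of −A. For k = 2, 3 it counts edges and triangles up to sign, and for k = 4, in a triangle-free graph,
-- the 4-sets having exactly one perfect matching (those inducing P₄ or 2K₂). So G is triangle-free, with
-- n + 2 edges and n such 4-sets, two fewer than edges.
--
-- If G contained an induced 2K₂, C₅ or half graph H₃, there would be too many of these 4-sets: inside each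
-- of the three graphs they number at least the edges minus one, and adding the other vertices of G one at a
-- time, each new edge can be charged to a new 4-set of its own. Hence G contains none of the three.
-- As n > 0, some 4-set has exactly one perfect matching, and thus induces a path a b c d. Excluding 2K₂, C₅,
-- H₃ and triangles then forces every non-isolated vertex to be a twin of a vertex of the path.
module Submission where

open import Defs hiding (sym) renaming (_∈_ to _∈ᵥ_)
open import Data.Bool using (Bool; true; false; _∧_; _∨_; _xor_; not; T; if_then_else_)
import Data.Bool.Properties as Bool
open import Data.Empty using (⊥; ⊥-elim)
open import Data.Fin using (Fin; zero; suc; punchIn; punchOut; toℕ; _≟_)
open import Data.Fin.Patterns using (0F; 1F; 2F; 3F)
open import Data.Fin.Properties using (all?; punchIn-punchOut; toℕ<n)
open import Data.Integer as ℤ using (ℤ; +_; -_; 0ℤ; 1ℤ) renaming (_+_ to _⊕_; _*_ to _⊗_)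
import Data.Integer.Properties as ℤ
open import Algebra.Properties.CommutativeMonoid.Sum ℤ.+-0-commutativeMonoid using (sum-remove; ∑-distrib-+)
open import Algebra.Properties.Semiring.Sum ℤ.+-*-semiring using (sum; sum-cong-≗; sum-replicate-zero; *-distribˡ-sum)
open import Data.Integer.Tactic.RingSolver using (solve-∀)
open import Data.List as List using (List; []; _∷_; _++_; length; allFin)
import Data.List.Properties as List
open import Data.List.Membership.Propositional using (_∈_)
open import Data.List.Membership.Propositional.Properties using (∈-allFin; ∈-∃++; ∈-++⁻)
open import Data.List.Relation.Binary.Permutation.Propositional using (_↭_; ↭-sym; ↭-trans; ↭-reflexive)
open _↭_ using (prep; swap)
import Data.List.Relation.Binary.Permutation.Propositional.Properties as Perm
import Data.List.Relation.Unary.All as All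
open import Data.List.Relation.Unary.AllPairs using ([]; _∷_)
open import Data.List.Relation.Unary.Any using (here; there)
open import Data.List.Relation.Unary.Unique.Propositional using (Unique)
import Data.List.Relation.Unary.Unique.Propositional.Properties as Unique
open import Data.Nat using (ℕ; zero; suc; _+_; _≤_; _<_; _≤ᵇ_; _<ᵇ_; _≡ᵇ_; s≤s; z≤n)
import Data.Nat.Properties as ℕ
open import Data.Nat.Tactic.RingSolver using () renaming (solve-∀ to ℕ-solve-∀)
open import Data.Product using (Σ; _×_; _,_; proj₁; proj₂; ∃)
open import Data.Sum using (_⊎_; inj₁; inj₂)
open import Data.Unit using (⊤; tt)
open import Data.Vec as Vec using (Vec; []; _∷_; lookup; insertAt; toList; fromList)
import Data.Vec.Properties as Vec
open import Function using (_∘_; id)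
open import Function.Bundles using (mk⇔; Equivalence)
open import Relation.Binary.Definitions using (tri<; tri≈; tri>)
open import Relation.Binary.PropositionalEquality
open import Relation.Nullary using (Dec; yes; no; does)
open import Relation.Nullary.Decidable using (from-yes; _→-dec_)

open ≡-Reasoning

-- Determinants of matrices A + x B

Matrix : ℕ → Set
Matrix n = Fin n → Fin n → ℤ

minor : ∀ {n} → Matrix (suc n) → Fin (suc n) → Fin (suc n) → Matrix n
minor M i c r k = M (punchIn i r) (punchIn c k)

-- Multiplication by `x`, acting on a sequence of coefficients.
shift : (ℕ → ℤ) → ℕ → ℤ
shift f zero    = 0ℤ
shift f (suc j) = f j

sgn : ∀ {n} → Fin n → ℤ
sgn zero    = 1ℤ
sgn (suc c) = - sgn c

-- pencil n A B j is the coefficient of xʲ in det (A + x B).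
pencil : ∀ n → Matrix n → Matrix n → ℕ → ℤ
pencil zero    A B zero    = 1ℤ
pencil zero    A B (suc _) = 0ℤ
pencil (suc n) A B j       = sum λ c →
  let d = pencil n (minor A zero c) (minor B zero c) in
  sgn c ⊗ (A zero c ⊗ d j ⊕ B zero c ⊗ shift d j)

shift-cong : ∀ {f g : ℕ → ℤ} → (∀ j → f j ≡ g j) → ∀ j → shift f j ≡ shift g j
shift-cong eq zero    = refl
shift-cong eq (suc j) = eq j

pencil-cong : ∀ n {A A′ B B′ : Matrix n} → (∀ i k → A i k ≡ A′ i k) → (∀ i k → B i k ≡ B′ i k) →
  ∀ j → pencil n A B j ≡ pencil n A′ B′ j
pencil-cong zero    eqA eqB zero    = refl
pencil-cong zero    eqA eqB (suc j) = refl
pencil-cong (suc n) eqA eqB j = sum-cong-≗ λ c →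
  let eqd = pencil-cong n (λ r k → eqA (suc r) (punchIn c k)) (λ r k → eqB (suc r) (punchIn c k)) in
  cong (sgn c ⊗_) (cong₂ _⊕_ (cong₂ _⊗_ (eqA zero c) (eqd j)) (cong₂ _⊗_ (eqB zero c) (shift-cong eqd j)))

-- With `B` zero no entry of the matrix contains `x`, so the determinant is constant.
pencil-zero : ∀ n {A B : Matrix n} → (∀ i k → B i k ≡ 0ℤ) → ∀ j → pencil n A B (suc j) ≡ 0ℤ
pencil-zero zero    eqB j = refl
pencil-zero (suc n) {A} {B} eqB j = trans (sum-cong-≗ vanish) (sum-replicate-zero (suc n))
  where
  d : Fin (suc n) → ℕ → ℤ
  d c = pencil n (minor A zero c) (minor B zero c)
  zeros : ∀ s a x → s ⊗ (a ⊗ 0ℤ ⊕ 0ℤ ⊗ x) ≡ 0ℤ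
  zeros = solve-∀
  vanish : ∀ c → sgn c ⊗ (A zero c ⊗ d c (suc j) ⊕ B zero c ⊗ d c j) ≡ 0ℤ
  vanish c = trans
    (cong₂ (λ x y → sgn c ⊗ (A zero c ⊗ x ⊕ y ⊗ d c j))
      (pencil-zero n (λ r k → eqB (suc r) (punchIn c k)) j) (eqB zero c))
    (zeros (sgn c) (A zero c) (d c j))

-- The position of column c after column punchIn c d has been deleted.
relocate : ∀ {n} → Fin (suc (suc n)) → Fin (suc n) → Fin (suc n)
relocate zero            d       = zero
relocate (suc c)         zero    = c
relocate {suc n} (suc c) (suc d) = suc (relocate c d)

punchIn-relocate : ∀ {n} (c : Fin (suc (suc n))) d → punchIn (punchIn c d) (relocate c d) ≡ c
punchIn-relocate zero            d       = refl
punchIn-relocate (suc c)         zero    = refl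
punchIn-relocate {suc n} (suc c) (suc d) = cong suc (punchIn-relocate c d)

punchIn-punchIn-relocate : ∀ {n} (c : Fin (suc (suc n))) d k →
  punchIn (punchIn c d) (punchIn (relocate c d) k) ≡ punchIn c (punchIn d k)
punchIn-punchIn-relocate zero            d       k       = refl
punchIn-punchIn-relocate (suc c)         zero    k       = refl
punchIn-punchIn-relocate {suc n} (suc c) (suc d) zero    = refl
punchIn-punchIn-relocate {suc n} (suc c) (suc d) (suc k) = cong suc (punchIn-punchIn-relocate c d k)

-- Of two columns, the right one has its position lowered by one exactly when the left one is
-- deleted first, so the two orders of deletion carry opposite signs.
sgn-relocate : ∀ {n} (c : Fin (suc (suc n))) d →
  sgn (punchIn c d) ⊗ sgn (relocate c d) ≡ - (sgn c ⊗ sgn d)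
sgn-relocate zero    d    = identity (sgn d)
  where
  identity : ∀ x → - x ⊗ 1ℤ ≡ - (1ℤ ⊗ x)
  identity = solve-∀
sgn-relocate (suc c) zero = identity (sgn c)
  where
  identity : ∀ x → 1ℤ ⊗ x ≡ - (- x ⊗ 1ℤ)
  identity = solve-∀
sgn-relocate {suc n} (suc c) (suc d) = begin
  - sgn (punchIn c d) ⊗ - sgn (relocate c d)  ≡⟨ cancel (sgn (punchIn c d)) (sgn (relocate c d)) ⟩
  sgn (punchIn c d) ⊗ sgn (relocate c d)      ≡⟨ sgn-relocate c d ⟩
  - (sgn c ⊗ sgn d)                           ≡⟨ cong -_ (sym (cancel (sgn c) (sgn d))) ⟩
  - (- sgn c ⊗ - sgn d)                       ∎
  where
  cancel : ∀ x y → - x ⊗ - y ≡ x ⊗ y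
  cancel = solve-∀

sgn²≡1 : ∀ {n} (c : Fin n) → sgn c ⊗ sgn c ≡ 1ℤ
sgn²≡1 zero    = refl
sgn²≡1 (suc c) = trans (cancel (sgn c)) (sgn²≡1 c)
  where
  cancel : ∀ x → - x ⊗ - x ≡ x ⊗ x
  cancel = solve-∀

shift-+* : ∀ s (f g h : ℕ → ℤ) → (∀ j → h j ≡ f j ⊕ s ⊗ g j) → ∀ j → shift h j ≡ shift f j ⊕ s ⊗ shift g j
shift-+* s f g h eq zero    = sym (trans (ℤ.+-identityˡ _) (ℤ.*-zeroʳ s))
shift-+* s f g h eq (suc j) = eq j

shift-pencil : ∀ {n} (A B : Matrix (suc n)) j → shift (pencil (suc n) A B) j ≡
  sum (λ c → let d = pencil n (minor A zero c) (minor B zero c) in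
             sgn c ⊗ (A zero c ⊗ shift d j ⊕ B zero c ⊗ shift (shift d) j))
shift-pencil {n} A B (suc j) = refl
shift-pencil {n} A B zero    = sym (trans (sum-cong-≗ (λ c → vanish (sgn c) (A zero c) (B zero c)))
                                          (sum-replicate-zero (suc n)))
  where
  vanish : ∀ s a b → s ⊗ (a ⊗ 0ℤ ⊕ b ⊗ 0ℤ) ≡ 0ℤ
  vanish = solve-∀

∀-punchIn : ∀ {n} (i : Fin (suc n)) {P : Fin (suc n) → Set} → P i → (∀ r → P (punchIn i r)) → ∀ r → P r
∀-punchIn i {P} p ps r with i ≟ r
... | yes refl = p
... | no  i≢r  = subst P (punchIn-punchOut i≢r) (ps (punchOut i≢r))

-- The determinant is affine in each entry, with the signed minor as slope, so one more `x` at
-- `(i, c)` adds `x` times that cofactor. For `i = zero` this is read off the expansion along the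
-- first row. Otherwise the minors of that expansion are handled by induction, and their corrections
-- reassemble into the expansion of the cofactor.
pencil-entry : ∀ n (A B B′ : Matrix (suc n)) i c →
  B i c ≡ B′ i c ⊕ 1ℤ →
  (∀ k → B i (punchIn c k) ≡ B′ i (punchIn c k)) →
  (∀ r k → B (punchIn i r) k ≡ B′ (punchIn i r) k) →
  ∀ j → pencil (suc n) A B j ≡
        pencil (suc n) A B′ j ⊕ (sgn i ⊗ sgn c) ⊗ shift (pencil n (minor A i c) (minor B i c)) j
pencil-entry n A B B′ zero c hit row rest j = begin
  sum t                                                    ≡⟨ sum-remove {i = c} t ⟩
  t c ⊕ sum (t ∘ punchIn c)                                ≡⟨ cong₂ _⊕_ at-c (sum-cong-≗ off-c) ⟩
  (t′ c ⊕ (1ℤ ⊗ sgn c) ⊗ δ) ⊕ sum (t′ ∘ punchIn c)          ≡⟨ rearrange (t′ c) _ _ ⟩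
  (t′ c ⊕ sum (t′ ∘ punchIn c)) ⊕ (1ℤ ⊗ sgn c) ⊗ δ          ≡⟨ cong (_⊕ (1ℤ ⊗ sgn c) ⊗ δ) (sym (sum-remove {i = c} t′)) ⟩
  sum t′ ⊕ (1ℤ ⊗ sgn c) ⊗ δ                                ∎
  where
  d d′ : Fin (suc n) → ℕ → ℤ
  d  e = pencil n (minor A zero e) (minor B zero e)
  d′ e = pencil n (minor A zero e) (minor B′ zero e)
  t t′ : Fin (suc n) → ℤ
  t  e = sgn e ⊗ (A zero e ⊗ d e j ⊕ B zero e ⊗ shift (d e) j)
  t′ e = sgn e ⊗ (A zero e ⊗ d′ e j ⊕ B′ zero e ⊗ shift (d′ e) j)
  δ = shift (d c) j
  d≡d′ : ∀ e j → d e j ≡ d′ e j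
  d≡d′ e = pencil-cong n (λ _ _ → refl) (λ r k → rest r (punchIn e k))
  rearrange : ∀ x y z → (x ⊕ y) ⊕ z ≡ (x ⊕ z) ⊕ y
  rearrange = solve-∀
  split : ∀ s a x b y → s ⊗ (a ⊗ x ⊕ (b ⊕ 1ℤ) ⊗ y) ≡ s ⊗ (a ⊗ x ⊕ b ⊗ y) ⊕ (1ℤ ⊗ s) ⊗ y
  split = solve-∀
  at-c : t c ≡ t′ c ⊕ (1ℤ ⊗ sgn c) ⊗ δ
  at-c rewrite hit | sym (d≡d′ c j) | sym (shift-cong (d≡d′ c) j) = split (sgn c) (A zero c) (d c j) (B′ zero c) δ
  off-c : ∀ e → t (punchIn c e) ≡ t′ (punchIn c e)
  off-c e rewrite row e | d≡d′ (punchIn c e) j | shift-cong (d≡d′ (punchIn c e)) j = refl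
pencil-entry (suc n) A B B′ (suc i) c hit row rest j = begin
  sum t                                                    ≡⟨ sum-remove {i = c} t ⟩
  t c ⊕ sum (t ∘ punchIn c)                                ≡⟨ cong₂ _⊕_ at-c (sum-cong-≗ off-c) ⟩
  t′ c ⊕ sum (λ e → t′ (punchIn c e) ⊕ s ⊗ u e)            ≡⟨ cong (t′ c ⊕_) (∑-distrib-+ (t′ ∘ punchIn c) (λ e → s ⊗ u e)) ⟩
  t′ c ⊕ (sum (t′ ∘ punchIn c) ⊕ sum (λ e → s ⊗ u e))      ≡⟨ sym (ℤ.+-assoc (t′ c) _ _) ⟩
  (t′ c ⊕ sum (t′ ∘ punchIn c)) ⊕ sum (λ e → s ⊗ u e)      ≡⟨ cong₂ _⊕_ (sym (sum-remove {i = c} t′)) (sym (*-distribˡ-sum s u)) ⟩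
  sum t′ ⊕ s ⊗ sum u
    ≡⟨ cong (λ z → sum t′ ⊕ s ⊗ z) (sym (shift-pencil (minor A (suc i) c) (minor B (suc i) c) j)) ⟩
  sum t′ ⊕ s ⊗ shift (pencil (suc n) (minor A (suc i) c) (minor B (suc i) c)) j ∎
  where
  s = - sgn i ⊗ sgn c
  d d′ : Fin (suc (suc n)) → ℕ → ℤ
  d  e = pencil (suc n) (minor A zero e) (minor B zero e)
  d′ e = pencil (suc n) (minor A zero e) (minor B′ zero e)
  t t′ : Fin (suc (suc n)) → ℤ
  t  e = sgn e ⊗ (A zero e ⊗ d e j ⊕ B zero e ⊗ shift (d e) j)
  t′ e = sgn e ⊗ (A zero e ⊗ d′ e j ⊕ B′ zero e ⊗ shift (d′ e) j)
  -- What is left after deleting rows `zero` and `suc i` and columns `c` and `punchIn c e`.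
  w : Fin (suc n) → ℕ → ℤ
  w e = pencil n (minor (minor A (suc i) c) zero e) (minor (minor B (suc i) c) zero e)
  v u : Fin (suc n) → ℤ
  v e = A zero (punchIn c e) ⊗ shift (w e) j ⊕ B′ zero (punchIn c e) ⊗ shift (shift (w e)) j
  u e = sgn e ⊗ (A zero (punchIn c e) ⊗ shift (w e) j ⊕ B zero (punchIn c e) ⊗ shift (shift (w e)) j)
  -- Deleting column `c` removes the only entry where `B` and `B′` differ.
  d≡d′ : ∀ j → d c j ≡ d′ c j
  d≡d′ = pencil-cong (suc n) {A = minor A zero c} (λ _ _ → refl)
    (∀-punchIn i {λ r → ∀ k → B (suc r) (punchIn c k) ≡ B′ (suc r) (punchIn c k)} row (λ r k → rest (suc r) (punchIn c k)))
  at-c : t c ≡ t′ c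
  at-c rewrite rest zero c | d≡d′ j | shift-cong d≡d′ j = refl
  -- Induction, with `relocate c e` as the column of the changed entry within the minor.
  step : ∀ e j → d (punchIn c e) j ≡ d′ (punchIn c e) j ⊕ (sgn i ⊗ sgn (relocate c e)) ⊗ shift (w e) j
  step e j = trans
    (pencil-entry n (minor A zero (punchIn c e)) (minor B zero (punchIn c e)) (minor B′ zero (punchIn c e)) i (relocate c e)
      (subst (λ k → B (suc i) k ≡ B′ (suc i) k ⊕ 1ℤ) (sym (punchIn-relocate c e)) hit)
      (λ k → subst (λ k → B (suc i) k ≡ B′ (suc i) k) (sym (punchIn-punchIn-relocate c e k)) (row (punchIn e k)))
      (λ r k → rest (suc r) (punchIn (punchIn c e) k)) j)
    (cong (λ z → d′ (punchIn c e) j ⊕ (sgn i ⊗ sgn (relocate c e)) ⊗ z)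
      (shift-cong (pencil-cong n (λ r k → cong (A _) (punchIn-punchIn-relocate c e k))
                                 (λ r k → cong (B _) (punchIn-punchIn-relocate c e k))) j))
  expand : ∀ p q si a b x y g h → p ⊗ (a ⊗ (x ⊕ (si ⊗ q) ⊗ g) ⊕ b ⊗ (y ⊕ (si ⊗ q) ⊗ h)) ≡
    p ⊗ (a ⊗ x ⊕ b ⊗ y) ⊕ (p ⊗ q) ⊗ (si ⊗ (a ⊗ g ⊕ b ⊗ h))
  expand = solve-∀
  contract : ∀ sc se si z → - (sc ⊗ se) ⊗ (si ⊗ z) ≡ (- si ⊗ sc) ⊗ (se ⊗ z)
  contract = solve-∀
  off-c : ∀ e → t (punchIn c e) ≡ t′ (punchIn c e) ⊕ s ⊗ u e
  off-c e rewrite step e j | shift-+* (sgn i ⊗ sgn (relocate c e)) _ _ _ (step e) j | rest zero (punchIn c e) =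
    trans (expand (sgn (punchIn c e)) (sgn (relocate c e)) (sgn i) (A zero (punchIn c e)) (B′ zero (punchIn c e)) _ _ _ _)
      (cong (t′ (punchIn c e) ⊕_)
        (trans (cong (_⊗ (sgn i ⊗ v e)) (sgn-relocate c e)) (contract (sgn c) (sgn e) (sgn i) (v e))))

-- Coefficients of `det` as values of `pencil`

coeff-padd : ∀ p q j → coeff (padd p q) j ≡ coeff p j ⊕ coeff q j
coeff-padd []      q       j       = sym (ℤ.+-identityˡ _)
coeff-padd (a ∷ p) []      j       = sym (ℤ.+-identityʳ _)
coeff-padd (a ∷ p) (b ∷ q) zero    = refl
coeff-padd (a ∷ p) (b ∷ q) (suc j) = coeff-padd p q j

coeff-pneg : ∀ p j → coeff (pneg p) j ≡ - coeff p j
coeff-pneg []      j       = refl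
coeff-pneg (a ∷ p) zero    = refl
coeff-pneg (a ∷ p) (suc j) = coeff-pneg p j

coeff-scale : ∀ a p j → coeff (List.map (a ⊗_) p) j ≡ a ⊗ coeff p j
coeff-scale a []      j       = sym (ℤ.*-zeroʳ a)
coeff-scale a (b ∷ p) zero    = refl
coeff-scale a (b ∷ p) (suc j) = coeff-scale a p j

coeff-altSum : ∀ m (f : Fin m → Poly) j → coeff (altSum m f) j ≡ sum (λ c → sgn c ⊗ coeff (f c) j)
coeff-altSum zero    f j = refl
coeff-altSum (suc m) f j = begin
  coeff (padd (f zero) (pneg (altSum m (f ∘ suc)))) j        ≡⟨ coeff-padd (f zero) _ j ⟩
  coeff (f zero) j ⊕ coeff (pneg (altSum m (f ∘ suc))) j     ≡⟨ cong₂ _⊕_ (sym (ℤ.*-identityˡ (coeff (f zero) j))) tail ⟩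
  1ℤ ⊗ coeff (f zero) j ⊕ sum (λ c → - sgn c ⊗ coeff (f (suc c)) j) ∎
  where
  tail : coeff (pneg (altSum m (f ∘ suc))) j ≡ sum (λ c → - sgn c ⊗ coeff (f (suc c)) j)
  tail = begin
    coeff (pneg (altSum m (f ∘ suc))) j              ≡⟨ coeff-pneg (altSum m (f ∘ suc)) j ⟩
    - coeff (altSum m (f ∘ suc)) j                   ≡⟨ cong -_ (coeff-altSum m (f ∘ suc) j) ⟩
    - sum (λ c → sgn c ⊗ coeff (f (suc c)) j)        ≡⟨ sym (ℤ.-1*i≡-i _) ⟩
    ℤ.-1ℤ ⊗ sum (λ c → sgn c ⊗ coeff (f (suc c)) j)  ≡⟨ *-distribˡ-sum ℤ.-1ℤ (λ c → sgn c ⊗ coeff (f (suc c)) j) ⟩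
    sum (λ c → ℤ.-1ℤ ⊗ (sgn c ⊗ coeff (f (suc c)) j)) ≡⟨ sum-cong-≗ (λ c → negate (sgn c) (coeff (f (suc c)) j)) ⟩
    sum (λ c → - sgn c ⊗ coeff (f (suc c)) j)        ∎
    where
    negate : ∀ x y → ℤ.-1ℤ ⊗ (x ⊗ y) ≡ - x ⊗ y
    negate = solve-∀

-- Covers together the two shapes of entry that occur in `charPoly`, namely `a + x` and `a`.
coeff-pmul : ∀ β a q j → coeff (pmul (if β then a ∷ 1ℤ ∷ [] else a ∷ []) q) j ≡
                         a ⊗ coeff q j ⊕ b2z β ⊗ shift (coeff q) j
coeff-pmul false a q j = begin
  coeff (padd (List.map (a ⊗_) q) (0ℤ ∷ [])) j      ≡⟨ coeff-padd (List.map (a ⊗_) q) _ j ⟩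
  coeff (List.map (a ⊗_) q) j ⊕ coeff (0ℤ ∷ []) j   ≡⟨ cong₂ _⊕_ (coeff-scale a q j) (zeros j) ⟩
  a ⊗ coeff q j ⊕ 0ℤ                                ∎
  where
  zeros : ∀ j → coeff (0ℤ ∷ []) j ≡ 0ℤ
  zeros zero    = refl
  zeros (suc j) = refl
coeff-pmul true a q j = begin
  coeff (padd (List.map (a ⊗_) q) r) j      ≡⟨ coeff-padd (List.map (a ⊗_) q) r j ⟩
  coeff (List.map (a ⊗_) q) j ⊕ coeff r j   ≡⟨ cong₂ _⊕_ (coeff-scale a q j) (shifted j) ⟩
  a ⊗ coeff q j ⊕ 1ℤ ⊗ shift (coeff q) j    ∎
  where
  r = 0ℤ ∷ pmul (1ℤ ∷ []) q
  shifted : ∀ j → coeff r j ≡ 1ℤ ⊗ shift (coeff q) j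
  shifted zero    = refl
  shifted (suc j) = trans (coeff-pmul false 1ℤ q j) (ℤ.+-identityʳ _)

coeff-det : ∀ n (β : Fin n → Fin n → Bool) (A : Matrix n) j →
  coeff (det n (λ i k → if β i k then A i k ∷ 1ℤ ∷ [] else A i k ∷ [])) j ≡ pencil n A (λ i k → b2z (β i k)) j
coeff-det zero    β A zero    = refl
coeff-det zero    β A (suc j) = refl
coeff-det (suc n) β A j =
  trans (coeff-altSum (suc n) (λ c → pmul (entry c) (cofactor c)) j) (sum-cong-≗ λ c → cong (sgn c ⊗_)
    (trans (coeff-pmul (β zero c) (A zero c) (cofactor c) j)
      (cong₂ (λ x y → A zero c ⊗ x ⊕ b2z (β zero c) ⊗ y) (expand c j) (shift-cong (expand c) j))))
  where
  entry cofactor : Fin (suc n) → Poly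
  entry c = if β zero c then A zero c ∷ 1ℤ ∷ [] else A zero c ∷ []
  cofactor c = det n (λ i k → if β (suc i) (punchIn c k) then minor A zero c i k ∷ 1ℤ ∷ [] else minor A zero c i k ∷ [])
  expand : ∀ c j → coeff (cofactor c) j ≡ pencil n (minor A zero c) (λ i k → b2z (β (suc i) (punchIn c k))) j
  expand c = coeff-det n (λ i k → β (suc i) (punchIn c k)) (minor A zero c)

-- The characteristic polynomial as a sum of principal minors

eqFin-refl : ∀ {n} (i : Fin n) → eqFin i i ≡ true
eqFin-refl zero    = refl
eqFin-refl (suc i) = eqFin-refl i

eqFin-punchIn : ∀ {n} (i : Fin (suc n)) k → eqFin i (punchIn i k) ≡ false
eqFin-punchIn zero    k       = refl
eqFin-punchIn (suc i) zero    = refl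
eqFin-punchIn (suc i) (suc k) = eqFin-punchIn i k

eqFin-punchIn₂ : ∀ {n} (i : Fin (suc n)) r k → eqFin (punchIn i r) (punchIn i k) ≡ eqFin r k
eqFin-punchIn₂ zero    r       k       = refl
eqFin-punchIn₂ (suc i) zero    zero    = refl
eqFin-punchIn₂ (suc i) zero    (suc k) = refl
eqFin-punchIn₂ (suc i) (suc r) zero    = refl
eqFin-punchIn₂ (suc i) (suc r) (suc k) = eqFin-punchIn₂ i r k

-- Sublists keep the order of the list, so on a list without repetitions each `k`-subset contributes
-- once.
sublistSum : ∀ {V : Set} k → (Vec V k → ℤ) → List V → ℤ
sublistSum zero    f l       = f []
sublistSum (suc k) f []      = 0ℤ
sublistSum (suc k) f (v ∷ l) = sublistSum k (f ∘ (v ∷_)) l ⊕ sublistSum (suc k) f l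

sublistSum-cong : ∀ {V : Set} k {f g : Vec V k → ℤ} → (∀ vs → f vs ≡ g vs) → ∀ l → sublistSum k f l ≡ sublistSum k g l
sublistSum-cong zero    eq l       = eq []
sublistSum-cong (suc k) eq []      = refl
sublistSum-cong (suc k) eq (v ∷ l) = cong₂ _⊕_ (sublistSum-cong k (eq ∘ (v ∷_)) l) (sublistSum-cong (suc k) eq l)

sublistSum-short : ∀ {V : Set} k (f : Vec V k → ℤ) l → length l < k → sublistSum k f l ≡ 0ℤ
sublistSum-short (suc k) f []      _       = refl
sublistSum-short (suc k) f (v ∷ l) (s≤s p) =
  cong₂ _⊕_ (sublistSum-short k (f ∘ (v ∷_)) l p) (sublistSum-short (suc k) f l (ℕ.m<n⇒m<1+n p))

module PrincipalMinors {V : Set} (a : V → V → ℤ) where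

  -- det (x F + a) on the listed vertices, where F is the diagonal matrix of the flags.
  flagged : ∀ {n} → Vec (V × Bool) n → ℕ → ℤ
  flagged {n} w = pencil n
    (λ i k → a (proj₁ (lookup w i)) (proj₁ (lookup w k)))
    (λ i k → if eqFin i k then b2z (proj₂ (lookup w i)) else 0ℤ)

  -- A flag is a single `x` on the diagonal, so `pencil-entry` applies with sign `sgn i ⊗ sgn i`,
  -- which is 1, and the cofactor belongs to the remaining vertices.
  flagged-insertAt : ∀ {n} (w : Vec (V × Bool) n) i v j →
    flagged (insertAt w i (v , true)) j ≡ flagged (insertAt w i (v , false)) j ⊕ shift (flagged w) j
  flagged-insertAt {n} w i v j = begin
    pencil (suc n) (A true) (B true) j
      ≡⟨ pencil-entry n (A true) (B true) (B false) i i hit row rest j ⟩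
    pencil (suc n) (A true) (B false) j ⊕ (sgn i ⊗ sgn i) ⊗ shift (pencil n (minor (A true) i i) (minor (B true) i i)) j
      ≡⟨ cong₂ _⊕_ (pencil-cong (suc n) {B = B false} sameA (λ _ _ → refl) j)
           (trans (cong₂ _⊗_ (sgn²≡1 i) (shift-cong (pencil-cong n minorA minorB) j)) (ℤ.*-identityˡ _)) ⟩
    pencil (suc n) (A false) (B false) j ⊕ shift (flagged w) j ∎
    where
    A B : Bool → Matrix (suc n)
    A β r k = a (proj₁ (lookup (insertAt w i (v , β)) r)) (proj₁ (lookup (insertAt w i (v , β)) k))
    B β r k = if eqFin r k then b2z (proj₂ (lookup (insertAt w i (v , β)) r)) else 0ℤ
    sameVertex : ∀ r → proj₁ (lookup (insertAt w i (v , true)) r) ≡ proj₁ (lookup (insertAt w i (v , false)) r)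
    sameVertex = ∀-punchIn i
      (trans (cong proj₁ (Vec.insertAt-lookup w i _)) (sym (cong proj₁ (Vec.insertAt-lookup w i _))))
      (λ r → trans (cong proj₁ (Vec.insertAt-punchIn w i _ r)) (sym (cong proj₁ (Vec.insertAt-punchIn w i _ r))))
    sameA : ∀ r k → A true r k ≡ A false r k
    sameA r k = cong₂ a (sameVertex r) (sameVertex k)
    hit : B true i i ≡ B false i i ⊕ 1ℤ
    hit rewrite eqFin-refl i | Vec.insertAt-lookup w i (v , true) | Vec.insertAt-lookup w i (v , false) = refl
    row : ∀ k → B true i (punchIn i k) ≡ B false i (punchIn i k)
    row k rewrite eqFin-punchIn i k = refl
    rest : ∀ r k → B true (punchIn i r) k ≡ B false (punchIn i r) k
    rest r k rewrite Vec.insertAt-punchIn w i (v , true) r | Vec.insertAt-punchIn w i (v , false) r = refl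
    minorA : ∀ r k → minor (A true) i i r k ≡ a (proj₁ (lookup w r)) (proj₁ (lookup w k))
    minorA r k rewrite Vec.insertAt-punchIn w i (v , true) r | Vec.insertAt-punchIn w i (v , true) k = refl
    minorB : ∀ r k → minor (B true) i i r k ≡ (if eqFin r k then b2z (proj₂ (lookup w r)) else 0ℤ)
    minorB r k rewrite Vec.insertAt-punchIn w i (v , true) r | eqFin-punchIn₂ i r k = refl

  flaggedList : List (V × Bool) → ℕ → ℤ
  flaggedList l = flagged (fromList l)

  -- The two sizes agree only propositionally, so each vector is packed with its length before the
  -- comparison.
  flagged-toList : ∀ {n} (w : Vec (V × Bool) n) j → flagged w j ≡ flaggedList (toList w) j
  flagged-toList w j = cong value (pack w)
    where
    Packed = Σ ℕ (Vec (V × Bool))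
    value : Packed → ℤ
    value (n , w) = flagged w j
    cons : V × Bool → Packed → Packed
    cons x (n , w) = suc n , x ∷ w
    pack : ∀ {n} (w : Vec (V × Bool) n) → _≡_ {A = Packed} (n , w) (length (toList w) , fromList (toList w))
    pack []      = refl
    pack (x ∷ w) = cong (cons x) (pack w)

  insertMiddle : ∀ (pre post : List (V × Bool)) →
    ∃ λ i → ∀ x → toList (insertAt (fromList (pre ++ post)) i x) ≡ pre ++ x ∷ post
  insertMiddle []        post = zero , λ x → cong (x ∷_) (toList∘fromList post)
    where
    toList∘fromList : ∀ (l : List (V × Bool)) → toList (fromList l) ≡ l
    toList∘fromList []      = refl
    toList∘fromList (x ∷ l) = cong (x ∷_) (toList∘fromList l)
  insertMiddle (y ∷ pre) post with insertMiddle pre post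
  ... | i , eq = suc i , λ x → cong (y ∷_) (eq x)

  flaggedList-middle : ∀ pre v post j →
    flaggedList (pre ++ (v , true) ∷ post) j ≡
    flaggedList (pre ++ (v , false) ∷ post) j ⊕ shift (flaggedList (pre ++ post)) j
  flaggedList-middle pre v post j with insertMiddle pre post
  ... | i , eq = begin
    flaggedList (pre ++ (v , true) ∷ post) j             ≡⟨ at true ⟨
    flagged (insertAt w i (v , true)) j                  ≡⟨ flagged-insertAt w i v j ⟩
    flagged (insertAt w i (v , false)) j ⊕ shift (flagged w) j ≡⟨ cong (_⊕ shift (flagged w) j) (at false) ⟩
    flaggedList (pre ++ (v , false) ∷ post) j ⊕ shift (flagged w) j ∎
    where
    w = fromList (pre ++ post)
    at : ∀ β → flagged (insertAt w i (v , β)) j ≡ flaggedList (pre ++ (v , β) ∷ post) j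
    at β = trans (flagged-toList (insertAt w i (v , β)) j) (cong (λ l → flaggedList l j) (eq (v , β)))

  off on : List V → List (V × Bool)
  off = List.map (_, false)
  on  = List.map (_, true)

  principalMinor : List V → ℤ
  principalMinor l = flaggedList (off l) 0

  off-suc : ∀ l j → flaggedList (off l) (suc j) ≡ 0ℤ
  off-suc l = pencil-zero _ noFlags
    where
    unflagged : ∀ (l : List V) i → proj₂ (lookup (fromList (off l)) i) ≡ false
    unflagged (v ∷ l) zero    = refl
    unflagged (v ∷ l) (suc i) = unflagged l i
    noFlags : ∀ i k → (if eqFin i k then b2z (proj₂ (lookup (fromList (off l)) i)) else 0ℤ) ≡ 0ℤ
    noFlags i k with eqFin i k
    ... | true  = cong b2z (unflagged l i)
    ... | false = refl

  off-∷ʳ : ∀ us v l → off us ++ (v , false) ∷ l ≡ off (us ++ v ∷ []) ++ l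
  off-∷ʳ []       v l = refl
  off-∷ʳ (u ∷ us) v l = cong (_ ∷_) (off-∷ʳ us v l)

  -- The first flagged vertex either joins the vertices of the minor or is deleted at the price of a
  -- factor `x`.
  unflag : ∀ us v l j → flaggedList (off us ++ on (v ∷ l)) j ≡
    flaggedList (off (us ++ v ∷ []) ++ on l) j ⊕ shift (flaggedList (off us ++ on l)) j
  unflag us v l j = trans (flaggedList-middle (off us) v (on l) j)
    (cong (λ m → flaggedList m j ⊕ shift (flaggedList (off us ++ on l)) j) (off-∷ʳ us v (on l)))

  flagged-high : ∀ us l j → length l < j → flaggedList (off us ++ on l) j ≡ 0ℤ
  flagged-high us []      (suc j) _       = trans (cong (λ m → flaggedList m (suc j)) (List.++-identityʳ (off us))) (off-suc us j)
  flagged-high us (v ∷ l) (suc j) (s≤s p) = trans (unflag us v l (suc j))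
    (cong₂ _⊕_ (flagged-high (us ++ v ∷ []) l (suc j) (ℕ.m<n⇒m<1+n p)) (flagged-high us l j p))

  -- The list `us` holds the vertices already chosen for the minor. The dichotomy of `unflag` for
  -- the next vertex matches the recursion of `sublistSum`.
  flagged-minors : ∀ us l k j → length l ≡ k + j →
    flaggedList (off us ++ on l) j ≡ sublistSum k (λ vs → principalMinor (us ++ toList vs)) l
  flagged-minors us []      zero    zero    refl =
    cong (λ m → flaggedList m 0) (trans (List.++-identityʳ (off us)) (cong off (sym (List.++-identityʳ us))))
  flagged-minors us (v ∷ l) zero    (suc j) eq = begin
    flaggedList (off us ++ on (v ∷ l)) (suc j)                          ≡⟨ unflag us v l (suc j) ⟩
    flaggedList (off (us ++ v ∷ []) ++ on l) (suc j) ⊕ flaggedList (off us ++ on l) j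
      -- The first summand vanishes because only `j` flags are left to produce the power `suc j`.
      ≡⟨ cong₂ _⊕_ (flagged-high (us ++ v ∷ []) l (suc j) (ℕ.≤-reflexive eq)) (flagged-minors us l zero j (ℕ.suc-injective eq)) ⟩
    0ℤ ⊕ principalMinor (us ++ [])                                      ≡⟨ ℤ.+-identityˡ _ ⟩
    principalMinor (us ++ [])                                           ∎
  flagged-minors us (v ∷ l) (suc k) j eq = begin
    flaggedList (off us ++ on (v ∷ l)) j                                ≡⟨ unflag us v l j ⟩
    flaggedList (off (us ++ v ∷ []) ++ on l) j ⊕ shift (flaggedList (off us ++ on l)) j
      ≡⟨ cong₂ _⊕_
           (trans (flagged-minors (us ++ v ∷ []) l k j (ℕ.suc-injective eq))
             (sublistSum-cong k (λ vs → cong principalMinor (List.++-assoc us (v ∷ []) (toList vs))) l))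
           (kept j eq) ⟩
    sublistSum k (f ∘ (v ∷_)) l ⊕ sublistSum (suc k) f l                ∎
    where
    f : Vec V (suc k) → ℤ
    f vs = principalMinor (us ++ toList vs)
    -- For `j = 0` the factor `x` rules out a contribution, and the sum on the right is empty
    -- because `l` has only `k` elements.
    kept : ∀ j → suc (length l) ≡ suc k + j → shift (flaggedList (off us ++ on l)) j ≡ sublistSum (suc k) f l
    kept zero    eq = sym (sublistSum-short (suc k) f l (ℕ.≤-reflexive (trans eq (ℕ.+-identityʳ (suc k)))))
    kept (suc j) eq = flagged-minors us l (suc k) j (trans (ℕ.suc-injective eq) (ℕ.+-suc k j))

module _ {N : ℕ} (G : Graph N) where

  open PrincipalMinors (λ u v → - b2z (adj G u v)) public using (principalMinor)
  open PrincipalMinors (λ u v → - b2z (adj G u v)) hiding (principalMinor)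

  coeff-charPoly : ∀ j → coeff (charPoly G) j ≡ flaggedList (on (allFin N)) j
  coeff-charPoly j = begin
    coeff (charPoly G) j                            ≡⟨ coeff-det N eqFin (λ u v → - b2z (adj G u v)) j ⟩
    pencil N _ (λ i k → b2z (eqFin i k)) j          ≡⟨ pencil-cong N vertex flag j ⟩
    flagged w j                                     ≡⟨ flagged-toList w j ⟩
    flaggedList (toList w) j                        ≡⟨ cong (λ l → flaggedList l j) (toList-tabulate id) ⟩
    flaggedList (on (allFin N)) j                   ∎
    where
    w : Vec (Fin N × Bool) N
    w = Vec.tabulate (_, true)
    vertex : ∀ i k → - b2z (adj G i k) ≡ - b2z (adj G (proj₁ (lookup w i)) (proj₁ (lookup w k)))
    vertex i k rewrite Vec.lookup∘tabulate {n = N} (_, true) i | Vec.lookup∘tabulate {n = N} (_, true) k = refl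
    flag : ∀ i k → b2z (eqFin i k) ≡ (if eqFin i k then b2z (proj₂ (lookup w i)) else 0ℤ)
    flag i k rewrite Vec.lookup∘tabulate {n = N} (_, true) i with eqFin i k
    ... | true  = refl
    ... | false = refl
    toList-tabulate : ∀ {n} (f : Fin n → Fin N) → toList (Vec.tabulate (λ i → f i , true)) ≡ on (List.tabulate f)
    toList-tabulate {zero}  f = refl
    toList-tabulate {suc n} f = cong (_ ∷_) (toList-tabulate (f ∘ suc))

  charPoly-minors : ∀ k j → N ≡ k + j → coeff (charPoly G) j ≡ sublistSum k (principalMinor ∘ toList) (allFin N)
  charPoly-minors k j eq = trans (coeff-charPoly j)
    (flagged-minors [] (allFin N) k j (trans (List.length-tabulate id) eq))

  charPoly-high : ∀ j → N < j → coeff (charPoly G) j ≡ 0ℤ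
  charPoly-high j N<j = trans (coeff-charPoly j)
    (flagged-high [] (allFin N) j (subst (_< j) (sym (List.length-tabulate id)) N<j))

-- Counting sublists

b2n : Bool → ℕ
b2n true  = 1
b2n false = 0

count : ∀ {V : Set} k → (Vec V k → Bool) → List V → ℕ
count zero    p l       = b2n (p [])
count (suc k) p []      = 0
count (suc k) p (v ∷ l) = count k (p ∘ (v ∷_)) l + count (suc k) p l

count-cong : ∀ {V : Set} k {p q : Vec V k → Bool} → (∀ vs → p vs ≡ q vs) → ∀ l → count k p l ≡ count k q l
count-cong zero    eq l       = cong b2n (eq [])
count-cong (suc k) eq []      = refl
count-cong (suc k) eq (v ∷ l) = cong₂ _+_ (count-cong k (eq ∘ (v ∷_)) l) (count-cong (suc k) eq l)

count-map : ∀ {U V : Set} k (p : Vec V k → Bool) (f : U → V) l → count k p (List.map f l) ≡ count k (p ∘ Vec.map f) l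
count-map zero    p f l       = refl
count-map (suc k) p f []      = refl
count-map (suc k) p f (v ∷ l) = cong₂ _+_ (count-map k (p ∘ (f v ∷_)) f l) (count-map (suc k) p f l)

count-none : ∀ {V : Set} k {p : Vec V k → Bool} → (∀ vs → p vs ≡ false) → ∀ l → count k p l ≡ 0
count-none zero    none l       = cong b2n (none [])
count-none (suc k) none []      = refl
count-none (suc k) none (v ∷ l) = cong₂ _+_ (count-none k (none ∘ (v ∷_)) l) (count-none (suc k) none l)

count-witness : ∀ {V : Set} k (p : Vec V k → Bool) l {m} → count k p l ≡ suc m → ∃ λ vs → p vs ≡ true
count-witness zero    p l eq with p [] in found
... | true = [] , found
count-witness (suc k) p (v ∷ l) eq with count k (p ∘ (v ∷_)) l in here
... | suc _ = let vs , found = count-witness k (p ∘ (v ∷_)) l here in v ∷ vs , found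
... | zero  = count-witness (suc k) p l eq

count-++ : ∀ {V : Set} k (p : Vec V k → Bool) us l → count k p l ≤ count k p (us ++ l)
count-++ zero    p us       l = ℕ.≤-refl
count-++ (suc k) p []       l = ℕ.≤-refl
count-++ (suc k) p (u ∷ us) l = ℕ.≤-trans (count-++ (suc k) p us l) (ℕ.m≤n+m _ _)

count-replicate-none : ∀ {V : Set} k (p : Vec V (suc k) → Bool) x → p (Vec.replicate (suc k) x) ≡ false →
  ∀ m → count (suc k) p (List.replicate m x) ≡ 0
count-replicate-none k       p x none zero    = refl
count-replicate-none zero    p x none (suc m) rewrite none = count-replicate-none zero p x none m
count-replicate-none (suc k) p x none (suc m) =
  cong₂ _+_ (count-replicate-none k (p ∘ (x ∷_)) x none m) (count-replicate-none (suc k) p x none m)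

count-replicate-all : ∀ {V : Set} (p : Vec V 1 → Bool) x → p (x ∷ []) ≡ true →
  ∀ m → count 1 p (List.replicate m x) ≡ m
count-replicate-all p x all zero    = refl
count-replicate-all p x all (suc m) rewrite all = cong suc (count-replicate-all p x all m)

-- Invariance under adjacent transpositions, in the form of the constructors `swap` and `prep` of
-- permutations.
Symmetric : ∀ {V : Set} k → (Vec V k → Bool) → Set
Symmetric zero          p = ⊤
Symmetric (suc zero)    p = ⊤
Symmetric (suc (suc k)) p = (∀ x y vs → p (x ∷ y ∷ vs) ≡ p (y ∷ x ∷ vs)) × (∀ x → Symmetric (suc k) (p ∘ (x ∷_)))

-- When two neighbours of the list are swapped, sublists with only one of them are merely counted in
-- another order. Symmetry is needed for the sublists that contain both.
count-↭ : ∀ {V : Set} k {p : Vec V k → Bool} → Symmetric k p → ∀ {l l′} → l ↭ l′ → count k p l ≡ count k p l′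
count-↭ zero          sp        perm              = refl
count-↭ (suc k)       sp        _↭_.refl          = refl
count-↭ (suc k)       sp        (_↭_.trans q r)   = trans (count-↭ (suc k) sp q) (count-↭ (suc k) sp r)
count-↭ (suc zero)    sp        (prep x q)        = cong (λ m → _ + m) (count-↭ 1 sp q)
count-↭ (suc (suc k)) sp        (prep x q)        = cong₂ _+_ (count-↭ (suc k) (proj₂ sp x) q) (count-↭ (suc (suc k)) sp q)
count-↭ (suc zero) {p} sp       (swap {xs} {ys} x y q) = begin
  b2n (p (x ∷ [])) + (b2n (p (y ∷ [])) + count 1 p xs) ≡⟨ cong (λ z → b2n (p (x ∷ [])) + (b2n (p (y ∷ [])) + z)) (count-↭ 1 sp q) ⟩
  b2n (p (x ∷ [])) + (b2n (p (y ∷ [])) + count 1 p ys) ≡⟨ exchange (b2n (p (x ∷ []))) (b2n (p (y ∷ []))) (count 1 p ys) ⟩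
  b2n (p (y ∷ [])) + (b2n (p (x ∷ [])) + count 1 p ys) ∎
  where
  exchange : ∀ a b c → a + (b + c) ≡ b + (a + c)
  exchange = ℕ-solve-∀
count-↭ {V} (suc (suc k)) {p} (sw , sx) (swap {xs} {ys} x y q) = begin
  (count k (pp x y) xs + count (suc k) (px x) xs) + (count (suc k) (px y) xs + count (suc (suc k)) p xs)
    ≡⟨ cong₂ _+_ (cong₂ _+_ (both x y) (count-↭ (suc k) (sx x) q)) (cong₂ _+_ (count-↭ (suc k) (sx y) q) (count-↭ (suc (suc k)) (sw , sx) q)) ⟩
  (count k (pp x y) ys + count (suc k) (px x) ys) + (count (suc k) (px y) ys + count (suc (suc k)) p ys)
    ≡⟨ cong (λ z → (z + count (suc k) (px x) ys) + (count (suc k) (px y) ys + count (suc (suc k)) p ys)) (count-cong k (sw x y) ys) ⟩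
  (count k (pp y x) ys + count (suc k) (px x) ys) + (count (suc k) (px y) ys + count (suc (suc k)) p ys)
    ≡⟨ exchange (count k (pp y x) ys) (count (suc k) (px x) ys) (count (suc k) (px y) ys) (count (suc (suc k)) p ys) ⟩
  (count k (pp y x) ys + count (suc k) (px y) ys) + (count (suc k) (px x) ys + count (suc (suc k)) p ys) ∎
  where
  px : V → Vec V (suc k) → Bool
  px x vs = p (x ∷ vs)
  pp : V → V → Vec V k → Bool
  pp x y vs = p (x ∷ y ∷ vs)
  inner : ∀ k {r : Vec V (suc k) → Bool} → Symmetric (suc k) r → ∀ y → Symmetric k (r ∘ (y ∷_))
  inner zero    sr y = tt
  inner (suc k) sr y = proj₂ sr y
  both : ∀ x y → count k (pp x y) xs ≡ count k (pp x y) ys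
  both x y = count-↭ k (inner k (sx x) y) q
  exchange : ∀ a b c d → (a + b) + (c + d) ≡ (a + c) + (b + d)
  exchange = ℕ-solve-∀

-- Moves chosen distinct vertices to the end of the list, so that the remaining ones can be added in
-- front one at a time.
extract : ∀ {V : Set} (bs : List V) → Unique bs → ∀ l → (∀ {b} → b ∈ bs → b ∈ l) → ∃ λ us → l ↭ us ++ bs
extract []       _            l sub = l , ↭-reflexive (sym (List.++-identityʳ l))
extract (b ∷ bs) (b∉bs ∷ uniq) l sub with extract bs uniq l (sub ∘ there)
... | us , l↭ with ∈-++⁻ us (Perm.∈-resp-↭ l↭ (sub (here refl)))
... | inj₂ b∈bs = ⊥-elim (All.lookup b∉bs b∈bs refl)
... | inj₁ b∈us with ∈-∃++ b∈us
... | us₁ , us₂ , refl = us₁ ++ us₂ , ↭-trans l↭ (↭-trans (Perm.++⁺ʳ bs (Perm.shift b us₁ us₂)) (↭-sym (Perm.shift b (us₁ ++ us₂) bs)))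

-- Edges, triangles and matchings of 4-sets

Rel : Set → Set
Rel V = V → V → Bool

edge : ∀ {V} → Rel V → Vec V 2 → Bool
edge E (a ∷ b ∷ []) = E a b

triangle : ∀ {V} → Rel V → Vec V 3 → Bool
triangle E (a ∷ b ∷ c ∷ []) = E a b ∧ (E b c ∧ E a c)

-- Without triangles, at most two of the three pairings of a, b, c, d are
-- perfect matchings, so odd parity means that exactly one is; the 4-set then
-- induces a path P₄ or 2K₂.
oneMatching : ∀ {V} → Rel V → Vec V 4 → Bool
oneMatching E (a ∷ b ∷ c ∷ d ∷ []) = (E a b ∧ E c d) xor ((E a c ∧ E b d) xor (E a d ∧ E b c))

module _ {U V : Set} {E : Rel V} {e : Rel U} (f : U → V) (hom : ∀ x y → E (f x) (f y) ≡ e x y) where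

  edge-map : ∀ us → edge E (Vec.map f us) ≡ edge e us
  edge-map (a ∷ b ∷ []) = hom a b

  oneMatching-map : ∀ us → oneMatching E (Vec.map f us) ≡ oneMatching e us
  oneMatching-map (a ∷ b ∷ c ∷ d ∷ [])
    rewrite hom a b | hom c d | hom a c | hom b d | hom a d | hom b c = refl

module _ {V : Set} {E : Rel V} (E-sym : ∀ u v → E u v ≡ E v u) where

  edge-symmetric : Symmetric 2 (edge E)
  edge-symmetric = (λ { x y [] → E-sym x y }) , λ _ → tt

  triangle-symmetric : Symmetric 3 (triangle E)
  triangle-symmetric = swap₁ , λ x → swap₂ x , λ _ → tt
    where
    swap₁ : ∀ x y vs → triangle E (x ∷ y ∷ vs) ≡ triangle E (y ∷ x ∷ vs)
    swap₁ x y (z ∷ []) = cong₂ _∧_ (E-sym x y) (Bool.∧-comm (E y z) (E x z))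
    swap₂ : ∀ x y z vs → triangle E (x ∷ y ∷ z ∷ vs) ≡ triangle E (x ∷ z ∷ y ∷ vs)
    swap₂ x y z [] rewrite E-sym z y with E x y | E y z | E x z
    ... | true  | true  | true  = refl
    ... | true  | true  | false = refl
    ... | true  | false | true  = refl
    ... | true  | false | false = refl
    ... | false | true  | true  = refl
    ... | false | true  | false = refl
    ... | false | false | true  = refl
    ... | false | false | false = refl

  oneMatching-symmetric : Symmetric 4 (oneMatching E)
  oneMatching-symmetric = swap₁ , λ x → swap₂ x , λ y → swap₃ x y , λ _ → tt
    where
    exchange : ∀ p q r → p xor (q xor r) ≡ q xor (p xor r)
    exchange true  true  r = refl
    exchange true  false r = refl
    exchange false true  r = refl
    exchange false false r = refl
    swap₁ : ∀ x y vs → oneMatching E (x ∷ y ∷ vs) ≡ oneMatching E (y ∷ x ∷ vs)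
    swap₁ x y (z ∷ w ∷ []) rewrite E-sym y x | Bool.∧-comm (E y z) (E x w) | Bool.∧-comm (E y w) (E x z) =
      cong ((E x y ∧ E z w) xor_) (Bool.xor-comm (E x z ∧ E y w) (E x w ∧ E y z))
    swap₂ : ∀ x y z vs → oneMatching E (x ∷ y ∷ z ∷ vs) ≡ oneMatching E (x ∷ z ∷ y ∷ vs)
    swap₂ x y z (w ∷ []) rewrite E-sym z y = exchange (E x y ∧ E z w) (E x z ∧ E y w) (E x w ∧ E y z)
    swap₃ : ∀ x y z w vs → oneMatching E (x ∷ y ∷ z ∷ w ∷ vs) ≡ oneMatching E (x ∷ y ∷ w ∷ z ∷ vs)
    swap₃ x y z w [] rewrite E-sym w z =
      cong ((E x y ∧ E z w) xor_) (Bool.xor-comm (E x z ∧ E y w) (E x w ∧ E y z))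

-- Small graphs built by cones, and a computable growth condition

cone : ∀ {k} → Rel (Fin k) → Vec Bool k → Rel (Fin (suc k))
cone e p zero    zero    = false
cone e p zero    (suc j) = lookup p j
cone e p (suc i) zero    = lookup p i
cone e p (suc i) (suc j) = e i j

∅ : Rel (Fin 0)
∅ ()

every : ∀ k → (Vec Bool k → Bool) → Bool
every zero    P = P []
every (suc k) P = every k (P ∘ (false ∷_)) ∧ every k (P ∘ (true ∷_))

∧-true : ∀ {a b} → a ∧ b ≡ true → a ≡ true × b ≡ true
∧-true {true} {true} refl = refl , refl

not-∨-true : ∀ {a b} → not a ∨ b ≡ true → a ≡ true → b ≡ true
not-∨-true eq refl = eq

every-sound : ∀ k {P} → every k P ≡ true → ∀ bs → P bs ≡ true
every-sound zero    eq []           = eq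
every-sound (suc k) eq (false ∷ bs) = every-sound k (proj₁ (∧-true eq)) bs
every-sound (suc k) eq (true ∷ bs)  = every-sound k (proj₂ (∧-true eq)) bs

≤ᵇ-true : ∀ {m n} → (m ≤ᵇ n) ≡ true → m ≤ n
≤ᵇ-true {m} {n} eq = ℕ.≤ᵇ⇒≤ m n (subst T (sym eq) tt)

module _ {k} (e : Rel (Fin k)) where

  member : Vec Bool k → Vec (Fin k) 1 → Bool
  member p (i ∷ []) = lookup p i

  common : Vec Bool k → Vec Bool k → Vec (Fin k) 1 → Bool
  common p r (i ∷ []) = lookup p i ∧ lookup r i

  edgeWithin : Vec Bool k → Vec (Fin k) 2 → Bool
  edgeWithin p (i ∷ j ∷ []) = lookup p i ∧ (e i j ∧ lookup p j)

  -- In a triangle-free graph, neighbourhoods are independent and adjacent vertices have disjoint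
  -- neighbourhoods. This test and `disjoint` restrict the enumeration accordingly.
  independent : Vec Bool k → Bool
  independent p = count 2 (edgeWithin p) (allFin k) ≡ᵇ 0

  disjoint : Vec Bool k → Vec Bool k → Bool
  disjoint p r = count 1 (common p r) (allFin k) ≡ᵇ 0

  withOne : Vec Bool k → Vec (Fin k) 3 → Bool
  withOne p is = oneMatching (cone e p) (zero ∷ Vec.map suc is)

  -- Vertex `zero` has neighbourhood `r` and vertex `suc zero` has neighbourhood `p`; the leading
  -- `true` is the edge joining them.
  withTwo : Vec Bool k → Vec Bool k → Vec (Fin k) 2 → Bool
  withTwo p r is = oneMatching (cone (cone e p) (true ∷ r)) (zero ∷ suc zero ∷ Vec.map (λ i → suc (suc i)) is)

  vertexGain : Vec Bool k → Bool
  vertexGain p = count 1 (member p) (allFin k) ≤ᵇ count 3 (withOne p) (allFin k)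

  edgeGain : Vec Bool k → Vec Bool k → Bool
  edgeGain p r = not (independent r ∧ disjoint p r) ∨ (1 ≤ᵇ count 2 (withTwo p r) (allFin k))

  -- e has at most one edge more than it has 4-sets with one perfect matching, and this persists when
  -- vertices are added without creating triangles: a new vertex with neighbourhood p in e brings at
  -- least as many such 4-sets meeting e in three vertices as it has neighbours in e, and each edge
  -- between two new vertices, with neighbourhoods p and r in e, lies in such a 4-set.
  anchored : Bool
  anchored = (count 2 (edge e) (allFin k) ≤ᵇ suc (count 4 (oneMatching e) (allFin k))) ∧
    every k λ p → not (independent p) ∨ (vertexGain p ∧ every k (edgeGain p))

  -- Guarantees that the entries of a vector inducing `e` are distinct, so that distinctness need
  -- not be assumed separately.
  TwinFree : Set
  TwinFree = ∀ i j → (∀ l → e i l ≡ e j l) → i ≡ j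

  twinFree? : Dec TwinFree
  twinFree? = all? λ i → all? λ j → all? (λ l → e i l Bool.≟ e j l) →-dec (i ≟ j)

K₃ : Rel (Fin 3)
K₃ = cone (cone (cone ∅ []) (true ∷ [])) (true ∷ true ∷ [])

-- Induced copies of small graphs and the bound they force

module Patterns {N} (G : Graph N) where

  private E = adj G

  cone-embedding : ∀ {k} {e : Rel (Fin k)} (xs : Vec (Fin N) k) →
    (∀ i j → E (lookup xs i) (lookup xs j) ≡ e i j) → ∀ v i j →
    E (lookup (v ∷ xs) i) (lookup (v ∷ xs) j) ≡ cone e (Vec.map (E v) xs) i j
  cone-embedding xs emb v zero    zero    = irrefl G v
  cone-embedding xs emb v zero    (suc j) = sym (Vec.lookup-map j (E v) xs)
  cone-embedding xs emb v (suc i) zero    = trans (Graph.sym G (lookup xs i) v) (sym (Vec.lookup-map i (E v) xs))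
  cone-embedding xs emb v (suc i) (suc j) = emb i j

  -- Built by cones like the concrete patterns, so that equality with a pattern reduces to
  -- equalities of Booleans.
  induced : ∀ {k} → Vec (Fin N) k → Rel (Fin k)
  induced []       = ∅
  induced (x ∷ xs) = cone (induced xs) (Vec.map (E x) xs)

  induced-lookup : ∀ {k} (xs : Vec (Fin N) k) i j → E (lookup xs i) (lookup xs j) ≡ induced xs i j
  induced-lookup (x ∷ xs) = cone-embedding xs (induced-lookup xs) x

  -- A repeated entry of `xs` would give two equal rows of `induced xs`.
  collect : ∀ {k} (xs : Vec (Fin N) k) → TwinFree (induced xs) →
    ∃ λ us → allFin N ↭ us ++ List.map (lookup xs) (allFin k)
  collect {k} xs twinFree = extract _ (Unique.map⁺ (λ {i} {j} → injective i j) (Unique.allFin⁺ k)) (allFin N) (λ _ → ∈-allFin _)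
    where
    injective : ∀ i j → lookup xs i ≡ lookup xs j → i ≡ j
    injective i j eq = twinFree i j λ l →
      trans (sym (induced-lookup xs i l)) (trans (cong (λ u → E u (lookup xs l)) eq) (induced-lookup xs j l))

  TriangleFree : Set
  TriangleFree = ∀ vs → triangle E vs ≡ false

  -- The count sees triples only in the order of `allFin`. A triangle listed in any order is
  -- therefore first moved to the end by a permutation, which preserves the count.
  triangleFree : count 3 (triangle E) (allFin N) ≡ 0 → TriangleFree
  triangleFree none (x ∷ y ∷ z ∷ []) with E x y in xy | E y z in yz | E x z in xz
  ... | false | _     | _     = refl
  ... | true  | false | _     = refl
  ... | true  | true  | false = refl
  ... | true  | true  | true  with collect (x ∷ y ∷ z ∷ []) (subst TwinFree (sym isK₃) (from-yes (twinFree? K₃)))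
    where
    isK₃ : induced (x ∷ y ∷ z ∷ []) ≡ K₃
    isK₃ rewrite xy | yz | xz = refl
  ... | us , perm = ⊥-elim (ℕ.1+n≰n (ℕ.≤-trans present absent))
    where
    bs = x ∷ y ∷ z ∷ []
    present : 1 ≤ count 3 (triangle E) bs
    present rewrite xy | yz | xz = s≤s z≤n
    absent : count 3 (triangle E) bs ≤ 0
    absent = ℕ.≤-trans (count-++ 3 (triangle E) us bs)
      (ℕ.≤-reflexive (trans (sym (count-↭ 3 (triangle-symmetric (Graph.sym G)) perm)) none))

  module Anchor (free : TriangleFree) {k} (xs : Vec (Fin N) k) (ok : anchored (induced xs) ≡ true) where

    e : Rel (Fin k)
    e = induced xs

    near : Fin N → Vec Bool k
    near v = Vec.map (E v) xs

    bs : List (Fin N)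
    bs = List.map (lookup xs) (allFin k)

    near-lookup : ∀ v i → lookup (near v) i ≡ E v (lookup xs i)
    near-lookup v i = Vec.lookup-map i (E v) xs

    near-independent : ∀ v → independent e (near v) ≡ true
    near-independent v = cong (_≡ᵇ 0) (count-none 2 {edgeWithin e (near v)} none (allFin k))
      where
      none : ∀ is → edgeWithin e (near v) is ≡ false
      none (i ∷ j ∷ []) rewrite near-lookup v i | near-lookup v j | sym (induced-lookup xs i j) =
        free (v ∷ lookup xs i ∷ lookup xs j ∷ [])

    near-disjoint : ∀ u v → E v u ≡ true → disjoint e (near u) (near v) ≡ true
    near-disjoint u v vu = cong (_≡ᵇ 0) (count-none 1 {common e (near u) (near v)} none (allFin k))
      where
      none : ∀ is → common e (near u) (near v) is ≡ false
      none (i ∷ []) rewrite near-lookup u i | near-lookup v i =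
        trans (cong (_∧ (E u (lookup xs i) ∧ E v (lookup xs i))) (sym vu)) (free (v ∷ u ∷ lookup xs i ∷ []))

    base : count 2 (edge E) bs ≤ suc (count 4 (oneMatching E) bs)
    base = subst₂ (λ m q → m ≤ suc q)
      (sym (trans (count-map 2 (edge E) (lookup xs) (allFin k)) (count-cong 2 (edge-map (lookup xs) (induced-lookup xs)) (allFin k))))
      (sym (trans (count-map 4 (oneMatching E) (lookup xs) (allFin k)) (count-cong 4 (oneMatching-map (lookup xs) (induced-lookup xs)) (allFin k))))
      (≤ᵇ-true (proj₁ (∧-true ok)))

    gains : ∀ v → vertexGain e (near v) ≡ true × every k (edgeGain e (near v)) ≡ true
    gains v = ∧-true (not-∨-true (every-sound k (proj₂ (∧-true ok)) (near v)) (near-independent v))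

    vertexToBase : ∀ v → count 1 (edge E ∘ (v ∷_)) bs ≤ count 3 (oneMatching E ∘ (v ∷_)) bs
    vertexToBase v = subst₂ _≤_
      (sym (trans (count-map 1 (edge E ∘ (v ∷_)) (lookup xs) (allFin k)) (count-cong 1 {q = member e (near v)} edges (allFin k))))
      (sym (trans (count-map 3 (oneMatching E ∘ (v ∷_)) (lookup xs) (allFin k)) (count-cong 3 {q = withOne e (near v)} matchings (allFin k))))
      (≤ᵇ-true (proj₁ (gains v)))
      where
      edges : ∀ is → edge E (v ∷ Vec.map (lookup xs) is) ≡ member e (near v) is
      edges (i ∷ []) = sym (near-lookup v i)
      matchings : ∀ is → oneMatching E (v ∷ Vec.map (lookup xs) is) ≡ withOne e (near v) is
      matchings is@(_ ∷ _ ∷ _ ∷ []) = oneMatching-map {E = E} (lookup (v ∷ xs)) (cone-embedding xs (induced-lookup xs) v) (zero ∷ Vec.map suc is)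

    edgeToBase : ∀ v u → b2n (E v u) ≤ count 2 (λ vs → oneMatching E (v ∷ u ∷ vs)) bs
    edgeToBase v u with E v u in vu
    ... | false = z≤n
    ... | true  = subst (1 ≤_)
      (sym (trans (count-map 2 (λ vs → oneMatching E (v ∷ u ∷ vs)) (lookup xs) (allFin k))
        (count-cong 2 {q = withTwo e (near u) (near v)} matchings (allFin k))))
      (≤ᵇ-true (not-∨-true (every-sound k (proj₂ (gains u)) (near v)) (cong₂ _∧_ (near-independent v) (near-disjoint u v vu))))
      where
      embedding : ∀ i j → E (lookup (v ∷ u ∷ xs) i) (lookup (v ∷ u ∷ xs) j) ≡ cone (cone e (near u)) (true ∷ near v) i j
      embedding i j = trans (induced-lookup (v ∷ u ∷ xs) i j) (cong (λ b → cone (cone e (near u)) (b ∷ near v) i j) vu)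
      matchings : ∀ is → oneMatching E (v ∷ u ∷ Vec.map (lookup xs) is) ≡ withTwo e (near u) (near v) is
      matchings is@(_ ∷ _ ∷ []) = oneMatching-map {E = E} (lookup (v ∷ u ∷ xs)) embedding (zero ∷ suc zero ∷ Vec.map (λ i → suc (suc i)) is)

    -- Edges from `v` into the copy are charged to 4-sets with three vertices of the copy. An edge
    -- to an added vertex `u` is charged to a 4-set made of `v`, `u` and two vertices of the copy,
    -- so the added vertices in a 4-set tell the charges apart.
    vertexBound : ∀ v us → count 1 (edge E ∘ (v ∷_)) (us ++ bs) ≤ count 3 (oneMatching E ∘ (v ∷_)) (us ++ bs)
    vertexBound v []       = vertexToBase v
    vertexBound v (u ∷ us) = ℕ.+-mono-≤
      (ℕ.≤-trans (edgeToBase v u) (count-++ 2 (λ vs → oneMatching E (v ∷ u ∷ vs)) us bs))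
      (vertexBound v us)

    -- Each added vertex brings at least as many one-matching 4-sets as edges, so the excess of
    -- edges stays at most one.
    bound : ∀ us → count 2 (edge E) (us ++ bs) ≤ suc (count 4 (oneMatching E) (us ++ bs))
    bound []       = base
    bound (u ∷ us) = ℕ.≤-trans (ℕ.+-mono-≤ (vertexBound u us) (bound us)) (ℕ.≤-reflexive (ℕ.+-suc _ _))

  anchored-bound : TriangleFree → ∀ {k} {e : Rel (Fin k)} → anchored e ≡ true → TwinFree e →
    (xs : Vec (Fin N) k) → induced xs ≡ e →
    count 2 (edge E) (allFin N) ≤ suc (count 4 (oneMatching E) (allFin N))
  anchored-bound free ok twinFree xs refl with collect xs twinFree
  ... | us , perm = subst₂ (λ m q → m ≤ suc q)
    (sym (count-↭ 2 (edge-symmetric (Graph.sym G)) perm))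
    (sym (count-↭ 4 (oneMatching-symmetric (Graph.sym G)) perm))
    (Anchor.bound free xs ok us)

-- Low-order minors of adjacency matrices

sublistSum-count : ∀ {V : Set} c k (p : Vec V k → Bool) l → sublistSum k (λ vs → c ⊗ b2z (p vs)) l ≡ c ⊗ + count k p l
sublistSum-count c zero    p l with p []
... | true  = refl
... | false = refl
sublistSum-count c (suc k) p []      = sym (ℤ.*-zeroʳ c)
sublistSum-count c (suc k) p (v ∷ l) = trans
  (cong₂ _⊕_ (sublistSum-count c k (p ∘ (v ∷_)) l) (sublistSum-count c (suc k) p l))
  (sym (ℤ.*-distribˡ-+ c (+ count k (p ∘ (v ∷_)) l) (+ count (suc k) p l)))

constantTerm : ∀ {k} → Rel (Fin k) → ℤ
constantTerm {k} e = pencil k (λ i j → - b2z (e i j)) (λ _ _ → 0ℤ) 0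

module Coefficients {N} (G : Graph N) where

  open Patterns G
  open PrincipalMinors (λ u v → - b2z (adj G u v)) using (flagged; flagged-toList; flaggedList)

  private E = adj G

  -- Reduces minors of `G` to determinants of Boolean patterns, which can be evaluated case by case.
  principalMinor-induced : ∀ {k} (xs : Vec (Fin N) k) → principalMinor G (toList xs) ≡ constantTerm (induced xs)
  principalMinor-induced {k} xs = begin
    principalMinor G (toList xs)        ≡⟨ cong (λ l → flaggedList l 0) (Vec.toList-map (_, false) xs) ⟨
    flaggedList (toList w) 0            ≡⟨ flagged-toList w 0 ⟨
    flagged w 0                         ≡⟨ pencil-cong k entries flags 0 ⟩
    constantTerm (induced xs)           ∎
    where
    w : Vec (Fin N × Bool) k
    w = Vec.map (_, false) xs
    entries : ∀ i j → - b2z (E (proj₁ (lookup w i)) (proj₁ (lookup w j))) ≡ - b2z (induced xs i j)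
    entries i j rewrite Vec.lookup-map i (_, false) xs | Vec.lookup-map j (_, false) xs =
      cong (-_ ∘ b2z) (induced-lookup xs i j)
    flags : ∀ i j → (if eqFin i j then b2z (proj₂ (lookup w i)) else 0ℤ) ≡ 0ℤ
    flags i j rewrite Vec.lookup-map i (_, false) xs with eqFin i j
    ... | true  = refl
    ... | false = refl

  minor₂ : ∀ vs → principalMinor G (toList vs) ≡ ℤ.-1ℤ ⊗ b2z (edge E vs)
  minor₂ vs@(a ∷ b ∷ []) = trans (principalMinor-induced vs) (value (E a b))
    where
    value : ∀ ab → constantTerm (cone (cone ∅ []) (ab ∷ [])) ≡ ℤ.-1ℤ ⊗ b2z ab
    value true  = refl
    value false = refl

  -- The two cyclic permutations contribute `-1` each on a triangle, whence the factor `-2`.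
  minor₃ : ∀ vs → principalMinor G (toList vs) ≡ ℤ.-[1+ 1 ] ⊗ b2z (triangle E vs)
  minor₃ vs@(a ∷ b ∷ c ∷ []) = trans (principalMinor-induced vs) (value (E a b) (E a c) (E b c))
    where
    value : ∀ ab ac bc → constantTerm (cone (cone (cone ∅ []) (bc ∷ [])) (ab ∷ ac ∷ [])) ≡ ℤ.-[1+ 1 ] ⊗ b2z (ab ∧ (bc ∧ ac))
    value true  true  true  = refl
    value true  true  false = refl
    value true  false true  = refl
    value true  false false = refl
    value false true  true  = refl
    value false true  false = refl
    value false false true  = refl
    value false false false = refl

  -- Each perfect matching contributes 1 and each 4-cycle `-2`. In the absence of triangles two
  -- matchings occur only in a 4-cycle, where the contributions cancel.
  minor₄ : TriangleFree → ∀ vs → principalMinor G (toList vs) ≡ 1ℤ ⊗ b2z (oneMatching E vs)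
  minor₄ free vs@(a ∷ b ∷ c ∷ d ∷ []) = trans (principalMinor-induced vs)
    (value (free (a ∷ b ∷ c ∷ [])) (free (a ∷ b ∷ d ∷ [])) (free (a ∷ c ∷ d ∷ [])) (free (b ∷ c ∷ d ∷ [])))
    where
    Four : Vec Bool 6 → Rel (Fin 4)
    Four (ab ∷ ac ∷ ad ∷ bc ∷ bd ∷ cd ∷ []) = cone (cone (cone (cone ∅ []) (cd ∷ [])) (bc ∷ bd ∷ [])) (ab ∷ ac ∷ ad ∷ [])
    triangles : Vec Bool 6 → Bool
    triangles (ab ∷ ac ∷ ad ∷ bc ∷ bd ∷ cd ∷ []) = (ab ∧ (bc ∧ ac)) ∨ ((ab ∧ (bd ∧ ad)) ∨ ((ac ∧ (cd ∧ ad)) ∨ (bc ∧ (cd ∧ bd))))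
    matches : Vec Bool 6 → Bool
    matches es = does (constantTerm (Four es) ℤ.≟ 1ℤ ⊗ b2z (oneMatching (Four es) (0F ∷ 1F ∷ 2F ∷ 3F ∷ [])))
    -- The `refl` runs through all 64 graphs on four vertices; those with a triangle pass by the
    -- first disjunct.
    checked : ∀ es → triangles es ≡ false → matches es ≡ true
    checked es none = subst (λ t → t ∨ matches es ≡ true) none (every-sound 6 {λ es → triangles es ∨ matches es} refl es)
    decided : ∀ {P : Set} (P? : Dec P) → does P? ≡ true → P
    decided (yes p) _ = p
    es = E a b ∷ E a c ∷ E a d ∷ E b c ∷ E b d ∷ E c d ∷ []
    value : triangle E (a ∷ b ∷ c ∷ []) ≡ false → triangle E (a ∷ b ∷ d ∷ []) ≡ false →
            triangle E (a ∷ c ∷ d ∷ []) ≡ false → triangle E (b ∷ c ∷ d ∷ []) ≡ false →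
            constantTerm (Four es) ≡ 1ℤ ⊗ b2z (oneMatching E vs)
    value abc abd acd bcd = decided (constantTerm (Four es) ℤ.≟ 1ℤ ⊗ b2z (oneMatching E vs))
      (checked es (cong₂ _∨_ abc (cong₂ _∨_ abd (cong₂ _∨_ acd bcd))))

  charPoly-count : ∀ c k (p : Vec (Fin N) k → Bool) → (∀ vs → principalMinor G (toList vs) ≡ c ⊗ b2z (p vs)) →
    ∀ j → N ≡ k + j → coeff (charPoly G) j ≡ c ⊗ + count k p (allFin N)
  charPoly-count c k p minors j N≡k+j = trans (charPoly-minors G k j N≡k+j)
    (trans (sublistSum-cong k minors (allFin N)) (sublistSum-count c k p (allFin N)))

-- Comparison of cospectral graphs

cospectral⇒sameOrder : ∀ {N M} (G : Graph N) (H : Graph M) → Cospectral G H → N ≡ M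
cospectral⇒sameOrder {N} {M} G H same with ℕ.<-cmp N M
... | tri≈ _ N≡M _ = N≡M
-- At the larger order, one polynomial has coefficient 0 and the other its leading coefficient 1.
... | tri< N<M _ _ with trans (sym (charPoly-high G M N<M)) (trans (same M) (charPoly-minors H 0 M refl))
... | ()
cospectral⇒sameOrder {N} {M} G H same | tri> _ _ M<N
  with trans (sym (charPoly-minors G 0 N refl)) (trans (same N) (charPoly-high H N M<N))
... | ()

module Cospectrality {N} (G H : Graph N) (same : Cospectral G H) where

  sameCount : ∀ c .{{_ : ℤ.NonZero c}} k {p q : Vec (Fin N) k → Bool} →
    (∀ vs → principalMinor G (toList vs) ≡ c ⊗ b2z (p vs)) →
    (∀ vs → principalMinor H (toList vs) ≡ c ⊗ b2z (q vs)) →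
    ∀ j → N ≡ k + j → count k p (allFin N) ≡ count k q (allFin N)
  sameCount c k {p} {q} minorsG minorsH j eq = ℤ.+-injective (ℤ.*-cancelˡ-≡ c _ _
    (trans (sym (Coefficients.charPoly-count G c k p minorsG j eq))
      (trans (same j) (Coefficients.charPoly-count H c k q minorsH j eq))))

-- Counts in the double star

-- The path 2 – 0 – 1 – 3: doubleStar 1 n is its blow-up with n copies of 3.
starType : Rel (Fin 4)
starType = cone (cone (cone (cone ∅ []) (false ∷ [])) (false ∷ true ∷ [])) (true ∷ true ∷ false ∷ [])

module DoubleStar (n : ℕ) where

  H : Graph (3 + n)
  H = doubleStar 1 n

  type : Fin (3 + n) → Fin 4
  type zero                = 0F
  type (suc zero)          = 1F
  type (suc (suc zero))    = 2F
  type (suc (suc (suc _))) = 3F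

  leaf : ∀ (i : Fin n) → (toℕ i <ᵇ n) ≡ true
  leaf i = Equivalence.to Bool.T-≡ (ℕ.<⇒<ᵇ (toℕ<n i))

  adj-type : ∀ u v → adj H u v ≡ starType (type u) (type v)
  adj-type zero                zero                = refl
  adj-type zero                (suc zero)          = refl
  adj-type zero                (suc (suc zero))    = refl
  adj-type zero                (suc (suc (suc j))) = refl
  adj-type (suc zero)          zero                = refl
  adj-type (suc zero)          (suc zero)          = refl
  adj-type (suc zero)          (suc (suc zero))    = refl
  adj-type (suc zero)          (suc (suc (suc j))) rewrite leaf j = refl
  adj-type (suc (suc zero))    zero                = refl
  adj-type (suc (suc zero))    (suc zero)          = refl
  adj-type (suc (suc zero))    (suc (suc zero))    = refl
  adj-type (suc (suc zero))    (suc (suc (suc j))) = refl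
  adj-type (suc (suc (suc i))) zero                = refl
  adj-type (suc (suc (suc i))) (suc zero)          rewrite leaf i = refl
  adj-type (suc (suc (suc i))) (suc (suc zero))    = refl
  adj-type (suc (suc (suc i))) (suc (suc (suc j))) = refl

  types : List (Fin 4)
  types = 0F ∷ 1F ∷ 2F ∷ List.replicate n 3F

  map-type : List.map type (allFin (3 + n)) ≡ types
  map-type = cong (λ l → 0F ∷ 1F ∷ 2F ∷ l) (leaves id)
    where
    leaves : ∀ {m} (f : Fin m → Fin n) → List.map type (List.tabulate (λ i → suc (suc (suc (f i))))) ≡ List.replicate m 3F
    leaves {zero}  f = refl
    leaves {suc m} f = cong (3F ∷_) (leaves (f ∘ suc))

  -- Adjacency depends only on types, so vertices may be counted by type, with `3F` repeated once
  -- for each of the `n` leaves.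
  count-types : ∀ k {p : Vec (Fin (3 + n)) k → Bool} {q : Vec (Fin 4) k → Bool} →
    (∀ vs → q (Vec.map type vs) ≡ p vs) → count k p (allFin (3 + n)) ≡ count k q types
  count-types k {p} {q} eq = trans (sym (count-cong k eq (allFin (3 + n))))
    (trans (sym (count-map k q type (allFin (3 + n)))) (cong (count k q) map-type))

  starType-free : ∀ x y z → triangle starType (x ∷ y ∷ z ∷ []) ≡ false
  starType-free = from-yes (all? λ x → all? λ y → all? λ z → triangle starType (x ∷ y ∷ z ∷ []) Bool.≟ false)

  free : Patterns.TriangleFree H
  free vs@(x ∷ y ∷ z ∷ []) = trans
    (cong₂ _∧_ (adj-type x y) (cong₂ _∧_ (adj-type y z) (adj-type x z))) (starType-free (type x) (type y) (type z))

  private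
    none : ∀ k (p : Vec (Fin 4) (suc k) → Bool) → p (Vec.replicate (suc k) 3F) ≡ false → count (suc k) p (List.replicate n 3F) ≡ 0
    none k p eq = count-replicate-none k p 3F eq n

  edges : count 2 (edge (adj H)) (allFin (3 + n)) ≡ 2 + n
  edges = trans (count-types 2 {q = E} (edge-map type (λ x y → sym (adj-type x y)))) total
    where
    E = edge starType
    total : count 2 E types ≡ 2 + n
    -- Vertex 0 has the two edges to 1 and 2, and vertex 1 has the `n` edges to its leaves.
    total rewrite none 0 (λ vs → E (0F ∷ vs)) refl
      | count-replicate-all (λ vs → E (1F ∷ vs)) 3F refl n
      | none 0 (λ vs → E (2F ∷ vs)) refl
      | none 1 E refl = cong (λ m → 2 + m) (ℕ.+-identityʳ n)

  matchings : count 4 (oneMatching (adj H)) (allFin (3 + n)) ≡ n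
  matchings = trans (count-types 4 {q = oneMatching starType} (oneMatching-map type (λ x y → sym (adj-type x y)))) total
    where
    M = oneMatching starType
    total : count 4 M types ≡ n
    -- Only 0, 1, 2 together with one leaf of 1 contribute; such a set induces a path.
    total rewrite count-replicate-all (λ vs → M (0F ∷ 1F ∷ 2F ∷ vs)) 3F refl n
      | none 1 (λ vs → M (0F ∷ 1F ∷ vs)) refl
      | none 1 (λ vs → M (0F ∷ 2F ∷ vs)) refl
      | none 2 (λ vs → M (0F ∷ vs)) refl
      | none 1 (λ vs → M (1F ∷ 2F ∷ vs)) refl
      | none 2 (λ vs → M (1F ∷ vs)) refl
      | none 2 (λ vs → M (2F ∷ vs)) refl
      | none 3 M refl = trans (ℕ.+-identityʳ _) (trans (ℕ.+-identityʳ _) (ℕ.+-identityʳ n))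

-- Triangle-free graphs with few one-matching 4-sets

2K₂ : Rel (Fin 4)
2K₂ = cone (cone (cone (cone ∅ []) (true ∷ [])) (false ∷ false ∷ [])) (true ∷ false ∷ false ∷ [])

C₅ : Rel (Fin 5)
C₅ = cone (cone (cone (cone (cone ∅ []) (true ∷ [])) (true ∷ false ∷ [])) (true ∷ false ∷ false ∷ [])) (true ∷ false ∷ false ∷ true ∷ [])

-- The half graph: rows a₁, a₂, a₃ and columns b₁, b₂, b₃, with aᵢ adjacent to bⱼ iff i ≤ j.
H₃ : Rel (Fin 6)
H₃ = cone (cone (cone (cone (cone (cone ∅ []) (false ∷ [])) (false ∷ false ∷ []))
  (false ∷ false ∷ true ∷ [])) (false ∷ false ∷ true ∷ true ∷ [])) (false ∷ false ∷ true ∷ true ∷ true ∷ [])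

∧-not : ∀ {p q} → p ∧ not q ≡ true → p ≡ true × q ≡ false
∧-not {true} {false} refl = refl , refl

∧-not⁺ : ∀ {p q} → p ≡ true → q ≡ false → p ∧ not q ≡ true
∧-not⁺ refl refl = refl

∪-to : ∀ {N} {S T : VSet N} v → v ∈ᵥ (S ∪ T) → v ∈ᵥ S ⊎ v ∈ᵥ T
∪-to {S = S} v v∈ with S v
... | true  = inj₁ refl
... | false = inj₂ v∈

∪-from : ∀ {N} {S T : VSet N} v → v ∈ᵥ S ⊎ v ∈ᵥ T → v ∈ᵥ (S ∪ T)
∪-from {S = S} {T} v (inj₁ v∈S) = cong (_∨ T v) v∈S
∪-from {S = S} {T} v (inj₂ v∈T) = trans (cong (S v ∨_) v∈T) (Bool.∨-zeroʳ (S v))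

module Structure {N} (G : Graph N) (free : Patterns.TriangleFree G)
  (sparse : suc (count 4 (oneMatching (adj G)) (allFin N)) < count 2 (edge (adj G)) (allFin N)) where

  open Patterns G

  infix 4 _~_ _≁_
  _~_ _≁_ : Fin N → Fin N → Set
  u ~ v = adj G u v ≡ true
  u ≁ v = adj G u v ≡ false

  ~-sym : ∀ {u v} → u ~ v → v ~ u
  ~-sym {u} {v} uv = trans (Graph.sym G v u) uv

  ≁-sym : ∀ {u v} → u ≁ v → v ≁ u
  ≁-sym {u} {v} uv = trans (Graph.sym G v u) uv

  absurd : ∀ {u v} → u ~ v → u ≁ v → ⊥
  absurd uv nuv with trans (sym uv) nuv
  ... | ()

  ≁-through : ∀ {u v w} → u ~ v → v ~ w → u ≁ w
  ≁-through {u} {v} {w} uv vw = trans (sym (cong₂ (λ a b → a ∧ (b ∧ adj G u w)) uv vw)) (free (u ∷ v ∷ w ∷ []))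

  excluded : ∀ {k} {e : Rel (Fin k)} → anchored e ≡ true → TwinFree e → (xs : Vec (Fin N) k) → induced xs ≡ e → ⊥
  excluded ok twinFree xs eq = ℕ.<⇒≱ sparse (anchored-bound free ok twinFree xs eq)

  no2K₂ : ∀ {a b c d} → a ~ b → c ~ d → a ≁ c → a ≁ d → b ≁ c → b ≁ d → ⊥
  no2K₂ {a} {b} {c} {d} ab cd ac ad bc bd = excluded {e = 2K₂} refl (from-yes (twinFree? 2K₂)) (a ∷ b ∷ c ∷ d ∷ []) pattern₄
    where
    pattern₄ : induced (a ∷ b ∷ c ∷ d ∷ []) ≡ 2K₂
    pattern₄ rewrite ab | cd | ac | ad | bc | bd = refl

  -- A chord would close a triangle, so a closed walk of length five is an induced `C₅`.
  noC₅ : ∀ {a b c d e} → a ~ b → b ~ c → c ~ d → d ~ e → e ~ a → ⊥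
  noC₅ {a} {b} {c} {d} {e} ab bc cd de ea = excluded {e = C₅} refl (from-yes (twinFree? C₅)) (a ∷ b ∷ c ∷ d ∷ e ∷ []) pattern₅
    where
    pattern₅ : induced (a ∷ b ∷ c ∷ d ∷ e ∷ []) ≡ C₅
    pattern₅ rewrite ab | bc | cd | de | ~-sym ea | ≁-through ab bc | ≁-through bc cd | ≁-through cd de
      | ≁-sym (≁-through de ea) | ≁-sym (≁-through ea ab) = refl

  -- Each side is independent by triangle-freeness, since `b₃` is a common neighbour of the rows and
  -- `a₁` one of the columns.
  noH₃ : ∀ {a₁ a₂ a₃ b₁ b₂ b₃} → a₁ ~ b₁ → a₁ ~ b₂ → a₁ ~ b₃ → a₂ ~ b₂ → a₂ ~ b₃ → a₃ ~ b₃ →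
    a₂ ≁ b₁ → a₃ ≁ b₁ → a₃ ≁ b₂ → ⊥
  noH₃ {a₁} {a₂} {a₃} {b₁} {b₂} {b₃} e₁₁ e₁₂ e₁₃ e₂₂ e₂₃ e₃₃ n₂₁ n₃₁ n₃₂ =
    excluded {e = H₃} refl (from-yes (twinFree? H₃)) (a₁ ∷ a₂ ∷ a₃ ∷ b₁ ∷ b₂ ∷ b₃ ∷ []) pattern₆
    where
    pattern₆ : induced (a₁ ∷ a₂ ∷ a₃ ∷ b₁ ∷ b₂ ∷ b₃ ∷ []) ≡ H₃
    pattern₆ rewrite e₁₁ | e₁₂ | e₁₃ | e₂₂ | e₂₃ | e₃₃ | n₂₁ | n₃₁ | n₃₂
      | ≁-through e₁₃ (~-sym e₂₃) | ≁-through e₁₃ (~-sym e₃₃) | ≁-through e₂₃ (~-sym e₃₃)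
      | ≁-through (~-sym e₁₁) e₁₂ | ≁-through (~-sym e₁₁) e₁₃ | ≁-through (~-sym e₁₂) e₁₃ = refl

  -- The non-adjacencies `a ≁ c` and `b ≁ d` follow from triangle-freeness, so only that of the ends
  -- is recorded.
  record Path₄ : Set where
    field
      {a b c d} : Fin N
      ab : a ~ b
      bc : b ~ c
      cd : c ~ d
      ad : a ≁ d

  -- As `2K₂` is excluded, some edge joins the two matching edges. It becomes the middle of the
  -- path, and the ends are non-adjacent because otherwise there would be a second matching.
  matching⇒path : ∀ {a b c d} → a ~ b → c ~ d → (adj G a c ∧ adj G b d) ≡ false → (adj G a d ∧ adj G b c) ≡ false → Path₄
  matching⇒path {a} {b} {c} {d} ab cd ac∧bd ad∧bc
    with adj G a c in ac | adj G b d in bd | adj G a d in ad | adj G b c in bc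
  ... | true  | false | _     | _     = record { ab = ~-sym ab ; bc = ac ; cd = cd ; ad = bd }
  ... | false | true  | _     | _     = record { ab = ab ; bc = bd ; cd = ~-sym cd ; ad = ac }
  ... | false | false | true  | false = record { ab = ~-sym ab ; bc = ad ; cd = ~-sym cd ; ad = bc }
  ... | false | false | false | true  = record { ab = ab ; bc = bc ; cd = cd ; ad = ad }
  ... | false | false | false | false = ⊥-elim (no2K₂ ab cd ac ad bc bd)
  matching⇒path ab cd () ad∧bc | true | true | _ | _
  matching⇒path ab cd _ () | false | false | true | true

  path : ∀ vs → oneMatching (adj G) vs ≡ true → Path₄
  path (w ∷ x ∷ y ∷ z ∷ []) eq with adj G w x ∧ adj G y z in p | adj G w y ∧ adj G x z in q | adj G w z ∧ adj G x y in r
  ... | true  | false | false = let wx , yz = ∧-true p in matching⇒path wx yz q r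
  ... | false | true  | false = let wy , xz = ∧-true q in
    matching⇒path wy xz p (trans (cong (adj G w z ∧_) (Graph.sym G y x)) r)
  ... | false | false | true  = let wz , xy = ∧-true r in
    matching⇒path wz xy (trans (cong (adj G w x ∧_) (Graph.sym G z y)) p) (trans (cong (adj G w y ∧_) (Graph.sym G z x)) q)
  -- Three perfect matchings would make all six pairs adjacent, against triangle-freeness.
  ... | true  | true  | true  = let wx , _ = ∧-true p ; wy , _ = ∧-true q ; _ , xy = ∧-true r in
    ⊥-elim (absurd wy (≁-through wx xy))

  reverse : Path₄ → Path₄
  reverse P = record { ab = ~-sym cd ; bc = ~-sym bc ; cd = ~-sym ab ; ad = ≁-sym ad }
    where open Path₄ P

  -- Twin classes along the path

  module Half (P : Path₄) where
    open Path₄ P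

    -- If `y ≁ c`, then `y ~ d` closes a 5-cycle through the path, and `y ≁ d` leaves an induced
    -- `2K₂` on `y`, `a` and `c`, `d`.
    near-a⇒near-c : ∀ {y} → y ~ a → y ~ c
    near-a⇒near-c {y} ya with adj G y c in yc | adj G y d in yd
    ... | true  | _     = refl
    ... | false | true  = ⊥-elim (noC₅ ya ab bc cd (~-sym yd))
    ... | false | false = ⊥-elim (no2K₂ ya cd yc yd (≁-through ab bc) ad)

    -- Otherwise the rows `c`, `a`, `x` and the columns `d`, `y`, `b` form a half graph.
    outer-complete : ∀ {x y} → x ~ b → x ≁ d → y ~ a → x ~ y
    outer-complete {x} {y} xb xd ya with adj G x y in xy
    ... | true  = refl
    ... | false = ⊥-elim (noH₃ cd (~-sym (near-a⇒near-c ya)) (~-sym bc) (~-sym ya) ab xb ad xd xy)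

    -- The rows `c`, `a`, `v` and the columns `d`, `b`, `w` form a half graph.
    pendant : ∀ {v w} → v ~ w → w ~ a → v ≁ b → v ≁ d → ⊥
    pendant vw wa vb vd = noH₃ cd (~-sym bc) (~-sym (near-a⇒near-c wa)) ab (~-sym wa) vw ad vd vb

  module Blowup (P : Path₄) where
    open Path₄ P
    open Half P
    module Rev = Half (reverse P)

    -- Otherwise `y a` and `z d` are the edges of an induced `2K₂`; `y ~ c` and `z ~ b` exclude the
    -- cross edges `y d` and `z a`.
    inner-complete : ∀ {y z} → y ~ a → z ~ d → y ~ z
    inner-complete {y} {z} ya zd with adj G y z in yz
    ... | true  = refl
    ... | false = ⊥-elim (no2K₂ (~-sym ya) zd (≁-through ab (~-sym (Rev.near-a⇒near-c zd))) ad yz (≁-through (near-a⇒near-c ya) cd))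

    -- The intended twin classes of `a`, `b`, `c`, `d`. Members of `C` are also adjacent to `b`, and
    -- members of `B` to `c`, which is why `A` and `D` carry a second condition.
    A B C D : VSet N
    A v = adj G v b ∧ not (adj G v d)
    B v = adj G v a
    C v = adj G v d
    D v = adj G v c ∧ not (adj G v a)

    -- A neighbour `w` of such a `v` gives a half graph if it is adjacent to `a` or `d`. Otherwise
    -- `v w` forms an induced `2K₂` with `a b` or `c d`, unless `w` closes a triangle with `b` and
    -- `c`.
    dominated : ∀ {v w} → v ~ w → v ≁ a → v ≁ b → v ≁ c → v ≁ d → ⊥
    dominated {v} {w} vw va vb vc vd with adj G w a in wa | adj G w b in wb | adj G w c in wc | adj G w d in wd
    ... | true  | _     | _     | _     = pendant vw wa vb vd
    ... | _     | _     | _     | true  = Rev.pendant vw wd vc va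
    ... | false | false | _     | _     = no2K₂ vw ab va vb wa wb
    ... | false | true  | false | false = no2K₂ vw cd vc vd wc wd
    ... | false | true  | true  | false = absurd wc (≁-through wb bc)

    cover : ∀ v → NonIsolated G v → v ∈ᵥ (A ∪ (B ∪ (C ∪ D)))
    cover v (w , vw) with adj G v a in va | adj G v b in vb | adj G v c in vc | adj G v d in vd
    ... | true  | true  | _     | true  = refl
    ... | true  | true  | _     | false = refl
    ... | true  | false | _     | _     = refl
    ... | false | true  | _     | true  = refl
    ... | false | true  | _     | false = refl
    ... | false | false | _     | true  = refl
    ... | false | false | true  | false = refl
    ... | false | false | false | false = ⊥-elim (dominated vw va vb vc vd)

    nonIsolated : ∀ v → v ∈ᵥ (A ∪ (B ∪ (C ∪ D))) → NonIsolated G v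
    nonIsolated v v∈ with ∪-to {S = A} {B ∪ (C ∪ D)} v v∈
    ... | inj₁ v∈A = b , proj₁ (∧-not v∈A)
    ... | inj₂ v∈′ with ∪-to {S = B} {C ∪ D} v v∈′
    ... | inj₁ v∈B = a , v∈B
    ... | inj₂ v∈″ with ∪-to {S = C} {D} v v∈″
    ... | inj₁ v∈C = d , v∈C
    ... | inj₂ v∈D = c , proj₁ (∧-not v∈D)

    A∩B : Disjoint A B
    A∩B v (v∈A , v∈B) = absurd (proj₁ (∧-not v∈A)) (≁-through v∈B ab)

    B∩C : Disjoint B C
    B∩C v (v∈B , v∈C) = noC₅ v∈B ab bc cd (~-sym v∈C)

    C∩D : Disjoint C D
    C∩D v (v∈C , v∈D) = absurd v∈C (≁-through (proj₁ (∧-not v∈D)) cd)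

    partition : IsPartition4 G A B C D
    partition = a∈A , (b , ~-sym ab) , (c , cd) , d∈D , A∩B ,
      (λ v (v∈A , v∈C) → absurd v∈C (proj₂ (∧-not v∈A))) ,
      (λ v (v∈A , v∈D) → absurd (proj₁ (∧-not v∈D)) (≁-through (proj₁ (∧-not v∈A)) bc)) ,
      B∩C ,
      (λ v (v∈B , v∈D) → absurd v∈B (proj₂ (∧-not v∈D))) ,
      C∩D , λ v → mk⇔ (cover v) (nonIsolated v)
      where
      a∈A : Nonempty A
      a∈A = a , ∧-not⁺ ab ad
      d∈D : Nonempty D
      d∈D = d , ∧-not⁺ (~-sym cd) (≁-sym ad)

    -- The common neighbours `x` of `X` and `y` of `Y` make both sides independent, by
    -- triangle-freeness.
    completeBipartite : ∀ (X Y : VSet N) (x y : Fin N) → Disjoint X Y → Nonempty X → Nonempty Y →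
      (∀ {u v} → u ∈ᵥ X → v ∈ᵥ Y → u ~ v) → (∀ {u} → u ∈ᵥ X → u ~ x) → (∀ {v} → v ∈ᵥ Y → v ~ y) →
      InducedCompleteBipartite G (X ∪ Y)
    completeBipartite X Y x y X∩Y X≠∅ Y≠∅ complete nearX nearY = X , Y ,
      (λ v → mk⇔ (∪-to {S = X} {Y} v) (∪-from {S = X} {Y} v)) , X∩Y , X≠∅ , Y≠∅ , (λ u v → complete) ,
      (λ u v u∈ v∈ → ≁-through (nearX u∈) (~-sym (nearX v∈))) ,
      (λ u v u∈ v∈ → ≁-through (nearY u∈) (~-sym (nearY v∈)))

    blowup : Σ (VSet N) λ A → Σ (VSet N) λ B → Σ (VSet N) λ C → Σ (VSet N) λ D →
      IsPartition4 G A B C D ×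
      InducedCompleteBipartite G (A ∪ B) ×
      InducedCompleteBipartite G (B ∪ C) ×
      InducedCompleteBipartite G (C ∪ D)
    blowup = A , B , C , D , partition ,
      completeBipartite A B b a A∩B A≠∅ B≠∅
        (λ u∈ v∈ → let ub , ud = ∧-not u∈ in outer-complete ub ud v∈) (proj₁ ∘ ∧-not) id ,
      completeBipartite B C a d B∩C B≠∅ C≠∅ inner-complete id id ,
      completeBipartite C D d c C∩D C≠∅ D≠∅
        (λ u∈ v∈ → let vc , va = ∧-not v∈ in ~-sym (Rev.outer-complete vc va u∈)) id (proj₁ ∘ ∧-not)
      where
      A≠∅ = proj₁ partition
      B≠∅ = proj₁ (proj₂ partition)
      C≠∅ = proj₁ (proj₂ (proj₂ partition))
      D≠∅ = proj₁ (proj₂ (proj₂ (proj₂ partition)))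

-- Transfer of the counts from the double star

theorem3p6 : (n : ℕ) → 3 ≤ n → (N : ℕ) (G : Graph N) →
    Cospectral G (doubleStar 1 n) →
    Σ (VSet N) λ A → Σ (VSet N) λ B → Σ (VSet N) λ C → Σ (VSet N) λ D →
    IsPartition4 G A B C D ×
    InducedCompleteBipartite G (A ∪ B) ×
    InducedCompleteBipartite G (B ∪ C) ×
    InducedCompleteBipartite G (C ∪ D)
theorem3p6 (suc m) _ N G same with cospectral⇒sameOrder G (doubleStar 1 (suc m)) same
... | refl = Blowup.blowup P
  where
  n = suc m
  open DoubleStar n using (H; edges; matchings) renaming (free to H-free)
  open Cospectrality G H same
  module CG = Coefficients G
  module CH = Coefficients H
  free : Patterns.TriangleFree G
  free = Patterns.triangleFree G (trans (sameCount ℤ.-[1+ 1 ] 3 CG.minor₃ CH.minor₃ n refl)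
    (count-none 3 H-free (allFin (3 + n))))
  sameMatchings : count 4 (oneMatching (adj G)) (allFin (3 + n)) ≡ n
  -- The order is `4 + m`, so the 4-sets are read off the coefficient with index `m`.
  sameMatchings = trans (sameCount 1ℤ 4 (CG.minor₄ free) (CH.minor₄ H-free) m refl) matchings
  sameEdges : count 2 (edge (adj G)) (allFin (3 + n)) ≡ 2 + n
  sameEdges = trans (sameCount ℤ.-1ℤ 2 CG.minor₂ CH.minor₂ (suc n) refl) edges
  open Structure G free (subst₂ (λ q e → suc q < e) (sym sameMatchings) (sym sameEdges) ℕ.≤-refl)
  P : Path₄
  -- The count equals `suc m`, which is positive, so a one-matching 4-set exists.
  P = let vs , found = count-witness 4 (oneMatching (adj G)) (allFin (3 + n)) sameMatchings in path vs found
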